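{- The sets of patterns $\{112,2312\}$, $\{121,1223\}$ and $\{121,2213\}$ are pairwise $m$-equivalent, that is, $\{112,2312\}\sim\{121,1223\}\sim\{121,2213\}$.
   Context: A (finite, reduced) multiset is $S=1^{a_1}2^{a_2}\cdots k^{a_k}$ with $k\ge 1$ and all $a_i\ge 1$, meaning that $i$ occurs with multiplicity $a_i$. A multipermutation of $S$ is a word having exactly $a_i$ occurrences of each letter $i\in[k]=\{1,\dots,k\}$ and no other letters. A word $\pi=\pi_1\cdots\pi_n$ contains a pattern (word) $\rho=\rho_1\cdots\rho_\ell$ if there are indices $i(1)<\cdots<i(\ell)$ such that for all $a,b\in[\ell]$: $\pi_{i(a)}<\pi_{i(b)}$ iff $\rho_a<\rho_b$, and $\pi_{i(a)}>\pi_{i(b)}$ iff $\rho_a>\rho_b$; otherwise $\pi$ avoids $\rho$. For a set $P$ of patterns, $\mathrm{av}(S;P)$ is the number of multipermutations of $S$ that avoid every pattern in $P$. Two sets of patterns $P,Q$ are $m$-equivalent, written here $P\sim Q$, if $\mathrm{av}(S;P)=\mathrm{av}(S;Q)$ for every multiset $S$. -}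

module Defs where

open import Data.Nat using (ℕ; zero; suc; _+_; _≤_; _<_; _>_; s≤s; _≟_; _≡ᵇ_; _<?_; _≤?_; _>?_)
open import Data.Bool using (true; false)
open import Data.Nat.Properties using (+-0-commutativeMonoid; suc-injective)
open import Data.Fin as Fin using (Fin; zero; suc; toℕ)
import Data.Fin.Properties as Fin
open import Data.List using (List; []; _∷_; length; lookup; filter; map; upTo; cartesianProductWith)
open import Data.List.Properties using (∷-injective)
open import Data.List.Membership.Propositional using (_∈_)
open import Data.List.Membership.Propositional.Properties
  using (∈-map⁺; ∈-upTo⁺; ∈-filter⁺; ∈-filter⁻; ∈-cartesianProductWith⁺)
open import Data.List.Relation.Unary.Any using (here)
open import Data.List.Relation.Unary.All as All using (All; []; _∷_)
open import Data.List.Relation.Unary.AllPairs as AllPairs using ()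
open import Data.List.Relation.Unary.Unique.Propositional using (Unique)
import Data.List.Relation.Unary.Unique.Propositional.Properties as Unique
open import Data.Product using (∃; _×_; _,_; proj₂)
import Data.Vec.Functional as Vector
open import Function using (_∘_)
open import Function.Bundles using (_⇔_; mk⇔; Equivalence)
open import Relation.Binary.PropositionalEquality
  using (_≡_; refl; sym; trans; cong; cong₂; subst; subst₂; _≗_; module ≡-Reasoning)
open import Relation.Nullary using (¬_; Dec)
open import Relation.Nullary.Decidable using (map′; _×-dec_; _→-dec_; ¬?)
open import Relation.Unary using (Decidable)
open import Algebra.Properties.CommutativeMonoid.Sum +-0-commutativeMonoid
  using (sum; sum-cong-≗; ∑-distrib-+; sum-replicate-zero)

Word : Set
Word = List ℕ

-- The letter i ∈ [k] is represented by the index in Fin k with toℕ value i - 1,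
-- so mult j is the exponent of the letter suc (toℕ j).
record Multiset : Set where
  field
    k      : ℕ
    k≥1    : 1 ≤ k
    mult   : Fin k → ℕ
    mult≥1 : ∀ j → 1 ≤ mult j

letter : ∀ {k} → Fin k → ℕ
letter j = suc (toℕ j)

card : Multiset → ℕ
card S = sum (Multiset.mult S)

occ : ℕ → Word → ℕ
occ x π = length (filter (x ≟_) π)

IsMultiperm : Multiset → Word → Set
IsMultiperm S π = (∀ j → occ (letter j) π ≡ mult j) × All (λ x → 1 ≤ x × x ≤ k) π
  where open Multiset S

-- Positions are 0-based elements of Fin (length _).
IsOccurrence : (ρ π : Word) → (Fin (length ρ) → Fin (length π)) → Set
IsOccurrence ρ π i =
  (∀ a b → a Fin.< b → i a Fin.< i b) ×
  (∀ a b → ((lookup π (i a) < lookup π (i b)) ⇔ (lookup ρ a < lookup ρ b)) ×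
           ((lookup π (i a) > lookup π (i b)) ⇔ (lookup ρ a > lookup ρ b)))

Contains : Word → Word → Set
Contains π ρ = ∃ (IsOccurrence ρ π)

Avoids : Word → Word → Set
Avoids π ρ = ¬ Contains π ρ

AvoidsAll : List Word → Word → Set
AvoidsAll P π = All (Avoids π) P

IsAvoider : Multiset → List Word → Word → Set
IsAvoider S P π = IsMultiperm S π × AvoidsAll P π

infix 1 _⇔-dec_

_⇔-dec_ : ∀ {A B : Set} → Dec A → Dec B → Dec (A ⇔ B)
a? ⇔-dec b? = map′ (λ (f , g) → mk⇔ f g)
                   (λ e → Equivalence.to e , Equivalence.from e)
                   ((a? →-dec b?) ×-dec (b? →-dec a?))

-- Without function extensionality, searching the functions Fin m → Fin n
-- requires the predicate to respect pointwise equality.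
anyFunction? : ∀ {m n} {Q : (Fin m → Fin n) → Set} →
               (∀ {f g} → f ≗ g → Q f → Q g) → Decidable Q → Dec (∃ Q)
anyFunction? {zero}  resp Q? =
  map′ (λ q → none , q) (λ (f , q) → resp (λ ()) q) (Q? none)
  where
  none : Fin zero → Fin _
  none ()
anyFunction? {suc m} {n} {Q} resp Q? =
  map′ (λ (x , f , q) → (x Vector.∷ f) , q)
       (λ (f , q) → f zero , f ∘ suc , resp (λ { zero → refl ; (suc _) → refl }) q)
       (Fin.any? λ x → anyFunction? (resp ∘ ∷-cong x) (Q? ∘ (x Vector.∷_)))
  where
  ∷-cong : ∀ x {f g : Fin m → Fin n} → f ≗ g → (x Vector.∷ f) ≗ (x Vector.∷ g)
  ∷-cong x f≗g zero    = refl
  ∷-cong x f≗g (suc a) = f≗g a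

isOccurrence? : ∀ ρ π → Decidable (IsOccurrence ρ π)
isOccurrence? ρ π i =
  (Fin.all? λ a → Fin.all? λ b → (a Fin.<? b) →-dec (i a Fin.<? i b)) ×-dec
  (Fin.all? λ a → Fin.all? λ b →
     ((lookup π (i a) <? lookup π (i b)) ⇔-dec (lookup ρ a <? lookup ρ b)) ×-dec
     ((lookup π (i a) >? lookup π (i b)) ⇔-dec (lookup ρ a >? lookup ρ b)))

isOccurrence-resp : ∀ ρ π {f g} → f ≗ g → IsOccurrence ρ π f → IsOccurrence ρ π g
isOccurrence-resp ρ π f≗g (inc , iso) =
  (λ a b a<b → subst₂ Fin._<_ (f≗g a) (f≗g b) (inc a b a<b)) ,
  (λ a b → subst₂ (λ x y → ((lookup π x < lookup π y) ⇔ (lookup ρ a < lookup ρ b)) ×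
                           ((lookup π x > lookup π y) ⇔ (lookup ρ a > lookup ρ b)))
                  (f≗g a) (f≗g b) (iso a b))

contains? : ∀ π ρ → Dec (Contains π ρ)
contains? π ρ = anyFunction? (isOccurrence-resp ρ π) (isOccurrence? ρ π)

isMultiperm? : ∀ S → Decidable (IsMultiperm S)
isMultiperm? S π =
  (Fin.all? λ j → occ (letter j) π ≟ mult j) ×-dec
  All.all? (λ x → (1 ≤? x) ×-dec (x ≤? k)) π
  where open Multiset S

isAvoider? : ∀ S P → Decidable (IsAvoider S P)
isAvoider? S P π = isMultiperm? S π ×-dec All.all? (¬? ∘ contains? π) P

words : List ℕ → ℕ → List Word
words A zero    = [] ∷ []
words A (suc n) = cartesianProductWith _∷_ A (words A n)

-- Every multipermutation of S has length card S, so this filters a finite list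
-- containing all of them; see ∈-avoiders and avoiders-unique.
avoiders : Multiset → List Word → List Word
avoiders S P = filter (isAvoider? S P) (words (map suc (upTo (Multiset.k S))) (card S))

av : Multiset → List Word → ℕ
av S P = length (avoiders S P)

infix 4 _∼_

_∼_ : List Word → List Word → Set
P ∼ Q = ∀ S → av S P ≡ av S Q

-- Correctness of the enumeration: avoiders S P lists each avoider exactly once

∈-words : ∀ {A π} → All (_∈ A) π → π ∈ words A (length π)
∈-words []           = here refl
∈-words (x∈A ∷ π⊆A) = ∈-cartesianProductWith⁺ _∷_ x∈A (∈-words π⊆A)

words-unique : ∀ {A} → Unique A → ∀ n → Unique (words A n)
words-unique A! zero    = [] AllPairs.∷ AllPairs.[]
words-unique A! (suc n) = Unique.cartesianProductWith⁺ _∷_ ∷-injective A! (words-unique A! n)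

sum-occ-singleton : ∀ {k m} → m < k → sum {k} (λ j → occ (toℕ j) (m ∷ [])) ≡ 1
sum-occ-singleton {suc k} {zero}  _         = cong suc (sum-replicate-zero k)
sum-occ-singleton {suc k} {suc m} (s≤s m<k) =
  trans (sum-cong-≗ {k} (λ j → shift (toℕ j) m)) (sum-occ-singleton m<k)
  where
  shift : ∀ x y → occ (suc x) (suc y ∷ []) ≡ occ x (y ∷ [])
  shift x y with x ≡ᵇ y
  ... | true  = refl
  ... | false = refl

length≡sum-occ : ∀ k {π} → All (λ x → 1 ≤ x × x ≤ k) π →
                 length π ≡ sum {k} (λ j → occ (letter j) π)
length≡sum-occ k []                                    = sym (sum-replicate-zero k)
length≡sum-occ k {suc m ∷ π} ((_ , m<k) ∷ π⊆[k]) = begin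
  1 + length π
    ≡⟨ cong₂ _+_ (sym (sum-occ-singleton m<k)) (length≡sum-occ k π⊆[k]) ⟩
  sum {k} (λ j → occ (toℕ j) (m ∷ [])) + sum {k} (λ j → occ (letter j) π)
    ≡⟨ ∑-distrib-+ {k} (λ j → occ (toℕ j) (m ∷ [])) (λ j → occ (letter j) π) ⟨
  sum {k} (λ j → occ (toℕ j) (m ∷ []) + occ (letter j) π)
    ≡⟨ sum-cong-≗ {k} (λ j → sym (step (toℕ j))) ⟩
  sum {k} (λ j → occ (letter j) (suc m ∷ π)) ∎
  where
  open ≡-Reasoning
  step : ∀ x → occ (suc x) (suc m ∷ π) ≡ occ x (m ∷ []) + occ (suc x) π
  step x with x ≡ᵇ m
  ... | true  = refl
  ... | false = refl

multiperm-length : ∀ S {π} → IsMultiperm S π → length π ≡ card S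
multiperm-length S (occ≡mult , π⊆[k]) =
  trans (length≡sum-occ _ π⊆[k]) (sum-cong-≗ occ≡mult)

∈-avoiders : ∀ S P {π} → π ∈ avoiders S P ⇔ IsAvoider S P π
∈-avoiders S P {π} = mk⇔ (λ π∈ → proj₂ (∈-filter⁻ (isAvoider? S P) {xs = ws} π∈)) complete
  where
  open Multiset S
  ws = words (map suc (upTo k)) (card S)

  ∈-letters : ∀ {x} → 1 ≤ x × x ≤ k → x ∈ map suc (upTo k)
  ∈-letters (s≤s _ , x≤k) = ∈-map⁺ suc (∈-upTo⁺ x≤k)

  complete : IsAvoider S P π → π ∈ avoiders S P
  complete av@(mp , _) = ∈-filter⁺ (isAvoider? S P)
    (subst (λ n → π ∈ words (map suc (upTo k)) n) (multiperm-length S mp)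
           (∈-words (All.map ∈-letters (proj₂ mp))))
    av

avoiders-unique : ∀ S P → Unique (avoiders S P)
avoiders-unique S P = Unique.filter⁺ (isAvoider? S P)
  (words-unique (Unique.map⁺ suc-injective (Unique.upTo⁺ (Multiset.k S))) (card S))

{-# OPTIONS --safe #-}
-- Build the words by inserting the letters from the largest to the smallest.  Avoiding the pattern
-- of length 3 leaves only a choice of the place u | v of the first copy of the new letter c: the
-- further copies follow it immediately (121), or form the end of the word (112).  Each pattern of
-- length 4 has the form α 1 β, and forbids exactly the places with an α to the left and, over the
-- same two letters, a β to the right.  Let n be the number of allowed places other than the end.
-- A single copy turns n into n + 1 at each of the n + 1 places.  With a ≥ 2 copies, the end gives
-- n + a and the other places give 2, 3, …, n + 1 in some order.  So all three pairs of patterns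
-- have the same generating tree.
module Submission where

open import Defs
open import Data.Bool using (Bool; true; false; if_then_else_; not)
open import Data.Empty using (⊥; ⊥-elim)
open import Data.Fin as Fin using (Fin; zero; suc; toℕ)
open import Data.List
  using (List; []; _∷_; _++_; map; filter; length; lookup; replicate; upTo; downFrom; applyUpTo; concatMap)
open import Data.List.Membership.Propositional using (_∈_; find; lose)
open import Data.List.Membership.Propositional.Properties
  using (∈-lookup; ∈-map⁺; ∈-map⁻; ∈-concatMap⁺; ∈-concatMap⁻)
open import Data.List.Membership.Propositional.Properties.WithK using (unique∧set⇒bag)
open import Data.List.Properties
open import Data.List.Relation.Binary.BagAndSetEquality using (∼bag⇒↭)
open import Data.List.Relation.Binary.Permutation.Propositional
  using (_↭_; prep; ↭-refl; ↭-reflexive; ↭-trans; module PermutationReasoning)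
import Data.List.Relation.Binary.Permutation.Propositional.Properties as Perm
open import Data.List.Relation.Binary.Sublist.Propositional
  using (_⊆_; []; _∷_; _∷ʳ_; minimum; ⊆-refl; ⊆-trans; ⊆-reflexive; from∈; to∈)
open import Data.List.Relation.Binary.Sublist.Propositional.Properties
  using (++⁺; ++⁺ˡ; ++⁺ʳ; filter⁺; filter-⊆; All-resp-⊆; map⁺)
open import Data.List.Relation.Unary.All as All using (All; []; _∷_)
import Data.List.Relation.Unary.All.Properties as All
import Data.List.Relation.Unary.AllPairs as AllPairs
open import Data.List.Relation.Unary.Any as Any using (Any; here; there; any?; satisfied)
import Data.List.Relation.Unary.Any.Properties as Any
open import Data.List.Relation.Unary.Unique.Propositional using (Unique)
import Data.List.Relation.Unary.Unique.Propositional.Properties as Unique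
open import Data.Nat
open import Data.Nat.Properties hiding (_≟_)
open import Data.List.Relation.Binary.Sublist.DecPropositional _≟_ using (_⊆?_)
open import Data.Product using (Σ; ∃; ∃₂; _×_; _,_; proj₁; proj₂; map₁; map₂; uncurry)
open import Data.Sum as Sum using (_⊎_; inj₁; inj₂)
open import Function using (_∘_; id)
open import Function.Bundles using (_⇔_; mk⇔; Equivalence)
import Function.Properties.Equivalence as ⇔
open import Relation.Binary.Definitions using (tri<; tri≈; tri>)
open import Relation.Binary.PropositionalEquality
  using (_≡_; _≢_; refl; sym; trans; cong; cong₂; subst; subst₂; module ≡-Reasoning)
open import Relation.Nullary using (¬_; Dec; does; yes; no; contradiction)
open import Relation.Nullary.Decidable using (map′; _×-dec_; ¬?; dec-true; dec-false; does-⇔)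

-- A place p | q of the enlarged word is compared with the place that remains after deleting every
-- c. A forbidden configuration survives the deletion unless c is its smaller letter, so only
-- configurations of that kind can change the status of a place (`active-strip`), and each count
-- asks where they fit. With a single c: nowhere, since α β repeats its smaller letter. With all
-- copies at the end: nowhere, since α β contains a smaller letter followed by a larger one.
-- Otherwise the pairs part ways. For α = 23 and α = 22, α starts with c and has one more letter, so
-- it is complete only behind the letter next to the first c; there β is always found, up to the end
-- of the word. For 1223, α is empty and only the right-hand side matters: it is forbidden as soon
-- as it contains c c y. Hence the new size depends on the rank of the chosen site, from the left in
-- the first case and from the right in the second. The orders disagree, so levels of the tree are
-- compared as multisets (`↭`).

-- Pattern containment as embedding of sublists

MonoOn : Word → (ℕ → ℕ) → Set
MonoOn ρ h = ∀ {a b} → a ∈ ρ → b ∈ ρ → a < b → h a < h b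

-- The occurrence is described by its values instead of its positions. Equal letters of `ρ` get
-- equal images because `h` is a function, so monotonicity is all that remains to be required.
Matches : Word → Word → Set
Matches π ρ = ∃ λ h → MonoOn ρ h × map h ρ ⊆ π

lower : ∀ {n} (j : Fin (suc n)) → 0 < toℕ j → Fin n
lower (suc j) _ = j

suc-lower : ∀ {n} (j : Fin (suc n)) (0<j : 0 < toℕ j) → suc (lower j 0<j) ≡ j
suc-lower (suc j) _ = refl

increasing⇒⊆ : ∀ (h : ℕ → ℕ) (ρ π : Word) (i : Fin (length ρ) → Fin (length π)) →
               (∀ a b → a Fin.< b → i a Fin.< i b) →
               (∀ a → lookup π (i a) ≡ h (lookup ρ a)) → map h ρ ⊆ π
increasing⇒⊆ h [] π i inc eq = minimum π
increasing⇒⊆ h (r ∷ ρ) [] i inc eq with () ← i zero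
increasing⇒⊆ h (r ∷ ρ) (x ∷ π) i inc eq with i zero in i0
... | zero = trans (sym (eq zero)) (cong (lookup (x ∷ π)) i0)
             ∷ increasing⇒⊆ h ρ π i′ inc′ eq′
  where
  pos : ∀ a → 0 < toℕ (i (suc a))
  pos a = subst (λ j → toℕ j < toℕ (i (suc a))) i0 (inc zero (suc a) z<s)
  i′ : Fin (length ρ) → Fin (length π)
  i′ a = lower (i (suc a)) (pos a)
  inc′ : ∀ a b → a Fin.< b → i′ a Fin.< i′ b
  inc′ a b a<b = s<s⁻¹ (subst₂ Fin._<_ (sym (suc-lower _ (pos a))) (sym (suc-lower _ (pos b)))
                               (inc (suc a) (suc b) (s<s a<b)))
  eq′ : ∀ a → lookup π (i′ a) ≡ h (lookup ρ a)
  eq′ a = trans (cong (lookup (x ∷ π)) (suc-lower _ (pos a))) (eq (suc a))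
... | suc j = x ∷ʳ increasing⇒⊆ h (r ∷ ρ) π i′ inc′ eq′
  where
  pos : ∀ a → 0 < toℕ (i a)
  pos zero    = subst (λ j → 0 < toℕ j) (sym i0) z<s
  pos (suc a) = ≤-trans z<s (inc zero (suc a) z<s)
  i′ : Fin (suc (length ρ)) → Fin (length π)
  i′ a = lower (i a) (pos a)
  inc′ : ∀ a b → a Fin.< b → i′ a Fin.< i′ b
  inc′ a b a<b = s<s⁻¹ (subst₂ Fin._<_ (sym (suc-lower _ (pos a))) (sym (suc-lower _ (pos b)))
                               (inc a b a<b))
  eq′ : ∀ a → lookup π (i′ a) ≡ h (lookup (r ∷ ρ) a)
  eq′ a = trans (cong (lookup (x ∷ π)) (suc-lower _ (pos a))) (eq a)

⊆⇒increasing : ∀ (h : ℕ → ℕ) {ρ π : Word} → map h ρ ⊆ π →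
               Σ (Fin (length ρ) → Fin (length π)) λ i →
                 (∀ a b → a Fin.< b → i a Fin.< i b) ×
                 (∀ a → lookup π (i a) ≡ h (lookup ρ a))
⊆⇒increasing h {[]} _ = (λ ()) , (λ ()) , (λ ())
⊆⇒increasing h {r ∷ ρ} (x ∷ʳ τ) with i , inc , eq ← ⊆⇒increasing h {r ∷ ρ} τ =
  suc ∘ i , (λ a b a<b → s<s (inc a b a<b)) , eq
⊆⇒increasing h {r ∷ ρ} {x ∷ π} (refl ∷ τ) with i , inc , eq ← ⊆⇒increasing h {ρ} τ =
  i′ , inc′ , eq′
  where
  i′ : Fin (suc (length ρ)) → Fin (suc (length π))
  i′ zero    = zero
  i′ (suc a) = suc (i a)
  inc′ : ∀ a b → a Fin.< b → i′ a Fin.< i′ b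
  inc′ zero    (suc b) _         = z<s
  inc′ (suc a) (suc b) (s≤s a<b) = s<s (inc a b a<b)
  eq′ : ∀ a → lookup (h r ∷ π) (i′ a) ≡ h (lookup (r ∷ ρ) a)
  eq′ zero    = refl
  eq′ (suc a) = eq a

-- `h` reads off the image of a letter at one of its positions in `ρ`. The choice is immaterial: a
-- strict inequality between the images of two equal letters would be reflected to `ρ`.
contains⇒matches : ∀ {π ρ} → Contains π ρ → Matches π ρ
contains⇒matches {π} {ρ} (i , inc , iso) = h , mono , increasing⇒⊆ h ρ π i inc same
  where
  h : ℕ → ℕ
  h v with any? (v ≟_) ρ
  ... | yes v∈ρ = lookup π (i (Any.index v∈ρ))
  -- A filler: `MonoOn` and `map h ρ` only see the letters of `ρ`.
  ... | no  _   = 0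

  image : ∀ {v} → v ∈ ρ → ∃ λ a → v ≡ lookup ρ a × h v ≡ lookup π (i a)
  image {v} v∈ρ with any? (v ≟_) ρ
  ... | yes p = Any.index p , Any.lookup-index p , refl
  ... | no ¬p = contradiction v∈ρ ¬p

  mono : MonoOn ρ h
  mono a∈ b∈ a<b with a′ , refl , ha ← image a∈ | b′ , refl , hb ← image b∈ =
    subst₂ _<_ (sym ha) (sym hb) (Equivalence.from (proj₁ (iso a′ b′)) a<b)

  same : ∀ a → lookup π (i a) ≡ h (lookup ρ a)
  same a with a′ , ρa≡ , ha ← image (∈-lookup {xs = ρ} a)
    with <-cmp (lookup π (i a)) (lookup π (i a′))
  ... | tri< lt _ _ = contradiction ρa≡ (<⇒≢ (Equivalence.to (proj₁ (iso a a′)) lt))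
  ... | tri≈ _ eq _ = trans eq (sym ha)
  ... | tri> _ _ gt = contradiction (sym ρa≡) (<⇒≢ (Equivalence.to (proj₂ (iso a a′)) gt))

matches⇒contains : ∀ {π ρ} → Matches π ρ → Contains π ρ
matches⇒contains {π} {ρ} (h , mono , τ) with i , inc , eq ← ⊆⇒increasing h τ =
  i , inc , λ a b → order a b , order b a
  where
  order : ∀ a b → (lookup π (i a) < lookup π (i b)) ⇔ (lookup ρ a < lookup ρ b)
  order a b rewrite eq a | eq b = mk⇔ reflect (mono (∈-lookup {xs = ρ} a) (∈-lookup {xs = ρ} b))
    where
    reflect : h (lookup ρ a) < h (lookup ρ b) → lookup ρ a < lookup ρ b
    reflect lt with <-cmp (lookup ρ a) (lookup ρ b)
    ... | tri< p _ _ = p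
    ... | tri≈ _ p _ = contradiction (cong h p) (<⇒≢ lt)
    ... | tri> _ _ p = contradiction lt (<-asym (mono (∈-lookup {xs = ρ} b) (∈-lookup {xs = ρ} a) p))

-- Places in a word

SplitTest : Set
SplitTest = Word → Word → Bool

-- Only the splits in front of a letter are tested: the end of a word is always an allowed place.
sites : SplitTest → Word → List (Word × Word)
sites A []      = []
sites A (x ∷ w) = (if A [] (x ∷ w) then (([] , x ∷ w) ∷_) else id)
                    (map (map₁ (x ∷_)) (sites (A ∘ (x ∷_)) w))

indicator : Bool → ℕ
indicator b = if b then 1 else 0

count : SplitTest → Word → ℕ
count A []      = 0
count A (x ∷ w) = indicator (A [] (x ∷ w)) + count (A ∘ (x ∷_)) w

-- The place u | v itself, if allowed, is counted by `after` and not by `before`. So ranks from the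
-- left start at 0, and ranks from the right start at 1.
before after : SplitTest → Word → Word → ℕ
before A u v = count (λ p q → A p (q ++ v)) u
after  A u v = count (λ p q → A (u ++ p) q) v

count-++ : ∀ A u v → count A (u ++ v) ≡ before A u v + after A u v
count-++ A []      v = refl
count-++ A (x ∷ u) v = trans (cong (indicator (A [] (x ∷ u ++ v)) +_) (count-++ (A ∘ (x ∷_)) u v))
                             (sym (+-assoc (indicator (A [] (x ∷ u ++ v))) _ _))

count-cong : ∀ {A B} w → (∀ p x q → p ++ x ∷ q ≡ w → A p (x ∷ q) ≡ B p (x ∷ q)) →
             count A w ≡ count B w
count-cong []      A≗B = refl
count-cong (x ∷ w) A≗B = cong₂ _+_ (cong indicator (A≗B [] x w refl))
                                   (count-cong w λ p y q eq → A≗B (x ∷ p) y q (cong (x ∷_) eq))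

count-true : ∀ w → count (λ _ _ → true) w ≡ length w
count-true []      = refl
count-true (x ∷ w) = cong suc (count-true w)

count-false : ∀ w → count (λ _ _ → false) w ≡ 0
count-false []      = refl
count-false (x ∷ w) = count-false w

after-∷ : ∀ A u x v → after A u (x ∷ v) ≡ indicator (A u (x ∷ v)) + after A (u ++ x ∷ []) v
after-∷ A u x v = cong₂ _+_ (cong (λ u → indicator (A u (x ∷ v))) (++-identityʳ u))
                            (count-cong v λ p y q _ →
                              cong (λ u → A u (y ∷ q)) (sym (++-assoc u (x ∷ []) p)))

Site : SplitTest → Word → Word × Word → Set
Site A w (u , v) = u ++ v ≡ w × v ≢ [] × A u v ≡ true

sites-sound : ∀ A w → All (Site A w) (sites A w)
sites-sound A []      = []
sites-sound A (x ∷ w) with A [] (x ∷ w) in A≡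
... | true  = (refl , (λ ()) , A≡) ∷ All.map⁺ (All.map (map₁ (cong (x ∷_))) (sites-sound _ w))
... | false = All.map⁺ (All.map (map₁ (cong (x ∷_))) (sites-sound _ w))

sites-before : ∀ A w → map (uncurry (before A)) (sites A w) ≡ upTo (count A w)
sites-before A []      = refl
sites-before A (x ∷ w) with A [] (x ∷ w) in A≡ | sites-sound (A ∘ (x ∷_)) w | sites-before (A ∘ (x ∷_)) w
... | true  | sound | ih = cong (0 ∷_) (begin
  map (uncurry (before A)) (map (map₁ (x ∷_)) S) ≡⟨ map-∘ S ⟨
  map (λ (u , v) → before A (x ∷ u) v) S
    ≡⟨ map-cong-local (All.map (λ { {u , v} (refl , _) →
         cong (λ b → indicator b + before (A ∘ (x ∷_)) u v) A≡ }) sound) ⟩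
  map (suc ∘ uncurry (before (A ∘ (x ∷_)))) S ≡⟨ map-∘ S ⟩
  map suc (map (uncurry (before (A ∘ (x ∷_)))) S) ≡⟨ cong (map suc) ih ⟩
  map suc (upTo n) ≡⟨ map-upTo suc n ⟩
  applyUpTo suc n ∎)
  where
  open ≡-Reasoning
  S = sites (A ∘ (x ∷_)) w
  n = count (A ∘ (x ∷_)) w
... | false | sound | ih = begin
  map (uncurry (before A)) (map (map₁ (x ∷_)) S) ≡⟨ map-∘ S ⟨
  map (λ (u , v) → before A (x ∷ u) v) S
    ≡⟨ map-cong-local (All.map (λ { {u , v} (refl , _) →
         cong (λ b → indicator b + before (A ∘ (x ∷_)) u v) A≡ }) sound) ⟩
  map (uncurry (before (A ∘ (x ∷_)))) S ≡⟨ ih ⟩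
  upTo (count (A ∘ (x ∷_)) w) ∎
  where
  open ≡-Reasoning
  S = sites (A ∘ (x ∷_)) w

sites-after : ∀ A w → map (uncurry (after A)) (sites A w) ≡ map suc (downFrom (count A w))
sites-after A []      = refl
sites-after A (x ∷ w) with A [] (x ∷ w) in A≡
... | true  = cong₂ _∷_ (cong (λ b → indicator b + count (A ∘ (x ∷_)) w) A≡)
                        (trans (sym (map-∘ (sites (A ∘ (x ∷_)) w))) (sites-after (A ∘ (x ∷_)) w))
... | false = trans (sym (map-∘ (sites (A ∘ (x ∷_)) w))) (sites-after (A ∘ (x ∷_)) w)

-- Words with a minimal letter

strip : ℕ → Word → Word
strip c = filter (c <?_)

Above AtLeast : ℕ → Word → Set
Above   c = All (c <_)
AtLeast c = All (c ≤_)

weaken : ∀ {c w} → Above c w → AtLeast c w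
weaken = All.map <⇒≤

strip-above : ∀ {c w} → Above c w → strip c w ≡ w
strip-above = filter-all _

⊆-strip : ∀ {c σ w} → Above c σ → σ ⊆ w → σ ⊆ strip c w
⊆-strip {c} {σ} {w} σ>c τ = subst (_⊆ strip c w) (strip-above σ>c)
                                 (filter⁺ (c <?_) (c <?_) (λ { refl → id }) τ)

strip-∷ : ∀ c w → strip c (c ∷ w) ≡ strip c w
strip-∷ c w = filter-reject (c <?_) (n≮n c)

strip-++-∷ : ∀ {c u} w → Above c u → strip c (u ++ c ∷ w) ≡ u ++ strip c w
strip-++-∷ {c} {u} w u>c =
  trans (filter-++ (c <?_) u (c ∷ w)) (cong₂ _++_ (strip-above u>c) (strip-∷ c w))

strip-replicate : ∀ c m → strip c (replicate m c) ≡ []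
strip-replicate c zero    = refl
strip-replicate c (suc m) = trans (strip-∷ c _) (strip-replicate c m)

⊆-skip : ∀ {x u} {σ w : Word} → All (x ≢_) u → x ∷ σ ⊆ u ++ w → x ∷ σ ⊆ w
⊆-skip []          τ          = τ
⊆-skip (x≢y ∷ x∉u) (_ ∷ʳ τ)   = ⊆-skip x∉u τ
⊆-skip (x≢y ∷ x∉u) (x≡y ∷ _)  = contradiction x≡y x≢y

∉-above : ∀ {c w} → Above c w → All (c ≢_) w
∉-above = All.map <⇒≢

first-split : ∀ {c π} → AtLeast c π → c ∈ π → ∃₂ λ u r → π ≡ u ++ c ∷ r × Above c u × AtLeast c r
first-split (_ ∷ π≥c) (here refl) = [] , _ , refl , [] , π≥c
first-split {c} {x ∷ π} (c≤x ∷ π≥c) (there c∈π) with c ≟ x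
... | yes refl = [] , _ , refl , [] , π≥c
... | no c≢x with u , r , eq , u>c , r≥c ← first-split π≥c c∈π =
  x ∷ u , r , cong (x ∷_) eq , ≤∧≢⇒< c≤x c≢x ∷ u>c , r≥c

All-strip⁻ : ∀ {c} {P : ℕ → Set} {w} → AtLeast c w → P c → All P (strip c w) → All P w
All-strip⁻ {w = []} _ _ _ = []
All-strip⁻ {c} {P} {x ∷ w} (c≤x ∷ w≥c) pc ps with c <? x
... | yes c<x with px ∷ ps′ ← subst (All P) (filter-accept (c <?_) c<x) ps =
  px ∷ All-strip⁻ w≥c pc ps′
... | no c≮x with refl ← ≤-antisym c≤x (≮⇒≥ c≮x) =
  pc ∷ All-strip⁻ w≥c pc (subst (All P) (strip-∷ c w) ps)

∈-sites : ∀ A u x v → A u (x ∷ v) ≡ true → (u , x ∷ v) ∈ sites A (u ++ x ∷ v)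
∈-sites A [] x v A≡ rewrite A≡ = here refl
∈-sites A (y ∷ u) x v A≡ with A [] (y ∷ u ++ x ∷ v)
... | true  = there (∈-map⁺ (map₁ (y ∷_)) (∈-sites (A ∘ (y ∷_)) u x v A≡))
... | false = ∈-map⁺ (map₁ (y ∷_)) (∈-sites (A ∘ (y ∷_)) u x v A≡)

∷-⊆⇒⊆ : ∀ {x} {σ w : Word} → x ∷ σ ⊆ w → σ ⊆ w
∷-⊆⇒⊆ τ = ⊆-trans (_ ∷ʳ ⊆-refl) τ

∷-⊆-replicate : ∀ {c y} {σ : Word} m → y ∷ σ ⊆ replicate m c → y ≡ c
∷-⊆-replicate (suc m) (_ ∷ʳ τ)   = ∷-⊆-replicate m τ
∷-⊆-replicate (suc m) (refl ∷ τ) = refl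

-- No letter of `σ` can be matched with the displayed c. Either all of them are placed in `u`, or
-- one of them, the s of the conclusion, is placed in `r` and drags the c of the occurrence behind
-- it.
cut : ∀ {c σ τ r} u → Above c σ → σ ++ c ∷ τ ⊆ u ++ c ∷ r →
      σ ⊆ u ⊎ ∃ λ s → c < s × s ∷ c ∷ τ ⊆ r
cut u       []          τ                  = inj₁ (minimum u)
cut {σ = _ ∷ σ} [] (c<s ∷ σ>c) (_ ∷ʳ τ)    = inj₂ (_ , c<s , ⊆-trans (refl ∷ ++⁺ˡ σ ⊆-refl) τ)
cut []      (c<s ∷ σ>c) (refl ∷ τ)         = contradiction c<s (n≮n _)
cut (x ∷ u) (c<s ∷ σ>c) (_ ∷ʳ τ)           = Sum.map₁ (x ∷ʳ_) (cut u (c<s ∷ σ>c) τ)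
cut (x ∷ u) (c<s ∷ σ>c) (eq ∷ τ)           = Sum.map₁ (eq ∷_) (cut u σ>c τ)

occ-++ : ∀ x u v → occ x (u ++ v) ≡ occ x u + occ x v
occ-++ x u v = trans (cong length (filter-++ (x ≟_) u v)) (length-++ (filter (x ≟_) u))

occ-above : ∀ {c w} → Above c w → occ c w ≡ 0
occ-above w>c = cong length (filter-none _ (All.map <⇒≢ w>c))

occ-∷-≡ : ∀ x w → occ x (x ∷ w) ≡ suc (occ x w)
occ-∷-≡ x w = cong length (filter-accept (x ≟_) refl)

occ-∷-≢ : ∀ {x y} w → x ≢ y → occ x (y ∷ w) ≡ occ x w
occ-∷-≢ w x≢y = cong length (filter-reject (_ ≟_) x≢y)

occ-replicate : ∀ c m → occ c (replicate m c) ≡ m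
occ-replicate c zero    = refl
occ-replicate c (suc m) = trans (occ-∷-≡ c _) (cong suc (occ-replicate c m))

occ-strip : ∀ {c x} w → c < x → occ x (strip c w) ≡ occ x w
occ-strip []      c<x = refl
occ-strip {c} {x} (y ∷ w) c<x with c <? y
... | no c≮y = trans (cong (occ x) (filter-reject (c <?_) c≮y))
                     (trans (occ-strip w c<x) (sym (occ-∷-≢ w λ { refl → c≮y c<x })))
... | yes c<y = trans (cong (occ x) (filter-accept (c <?_) c<y)) (occ-y (x ≟ y))
  where
  occ-y : Dec (x ≡ y) → occ x (y ∷ strip c w) ≡ occ x (y ∷ w)
  occ-y (yes refl) = trans (occ-∷-≡ x _) (trans (cong suc (occ-strip w c<x)) (sym (occ-∷-≡ x w)))
  occ-y (no x≢y)   = trans (occ-∷-≢ _ x≢y) (trans (occ-strip w c<x) (sym (occ-∷-≢ w x≢y)))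

-- The pattern of length 3 and the position of the repeated letter

-- In patterns over two letters, false is the smaller letter.
inst : List Bool → ℕ → ℕ → Word
inst β x y = map (λ b → if b then y else x) β

-- Since γ begins with its smaller letter, an occurrence with c in that role can be moved to start
-- at the first copy of c. Its avoidance therefore restricts only what follows that copy, and `tail`
-- is the form which it forces there.
record Shape : Set where
  field
    γ′   : List Bool
    tail : ℕ → ℕ → Word → Word

  γ : List Bool
  γ = false ∷ γ′

  -- There are m + 1 copies of c, since its multiplicity is positive.
  ins : ℕ → ℕ → Word → Word → Word
  ins c m u v = u ++ c ∷ tail c m v

  field
    true∈γ′       : true ∈ γ′
    tail-zero     : ∀ c v → tail c 0 v ≡ v
    tail-[]       : ∀ c m → tail c m [] ≡ replicate m c
    strip-tail    : ∀ {c} m {v} → Above c v → strip c (tail c m v) ≡ v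
    tail-atLeast  : ∀ {c} m {v} → Above c v → AtLeast c (tail c m v)
    occ-tail      : ∀ {c} m {v} → Above c v → occ c (tail c m v) ≡ m
    -- Lets an occurrence of α c β start its c at the first copy of c.
    ¬sct⊆tail     : ∀ {c s t} m {v} → Above c v → c < s → c < t → ¬ (s ∷ c ∷ t ∷ [] ⊆ tail c m v)
    ¬γ⊆tail       : ∀ {c y} m {v} → Above c v → c < y → ¬ (inst γ c y ⊆ c ∷ tail c m v)
    decompose     : ∀ {c r} → AtLeast c r → (∀ {y} → c < y → ¬ (inst γ c y ⊆ c ∷ r)) →
                    ∃₂ λ m v → r ≡ tail c m v × Above c v

c∷σ⊈above : ∀ {c σ v} → Above c v → ¬ (c ∷ σ ⊆ v)
c∷σ⊈above v>c τ with c<c ∷ _ ← All-resp-⊆ τ v>c = n≮n _ c<c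

∷-⊆-∷ : ∀ {x y} {σ w : Word} → x ∷ σ ⊆ y ∷ w → σ ⊆ w
∷-⊆-∷ (_ ∷ʳ τ) = ∷-⊆⇒⊆ τ
∷-⊆-∷ (_ ∷ τ)  = τ

⊆-skip-replicate : ∀ {c s} {σ v : Word} m → c < s → s ∷ σ ⊆ replicate m c ++ v → s ∷ σ ⊆ v
⊆-skip-replicate m c<s = ⊆-skip (All.replicate⁺ m (>⇒≢ c<s))

-- What 121 leaves behind a first copy of c: no c comes after a larger letter.
leading-block : ∀ {c} r → AtLeast c r → (∀ {y} → c < y → ¬ (y ∷ c ∷ [] ⊆ r)) →
                ∃₂ λ m v → r ≡ replicate m c ++ v × Above c v
leading-block [] _ _ = 0 , [] , refl , []
leading-block {c} (x ∷ r) (c≤x ∷ r≥c) avoid with c ≟ x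
... | yes refl with m , v , eq , v>c ← leading-block r r≥c (λ c<y τ → avoid c<y (c ∷ʳ τ)) =
  suc m , v , cong (c ∷_) eq , v>c
... | no c≢x = 0 , x ∷ r , refl , c<x ∷ All.tabulate λ {y} y∈r →
  ≤∧≢⇒< (All.lookup r≥c y∈r) λ { refl → avoid c<x (refl ∷ from∈ y∈r) }
  where c<x = ≤∧≢⇒< c≤x c≢x

-- What 112 leaves behind a first copy of c: no larger letter comes after another c.
trailing-block : ∀ {c} r → AtLeast c r → (∀ {y} → c < y → ¬ (c ∷ y ∷ [] ⊆ r)) →
                 ∃₂ λ m v → r ≡ v ++ replicate m c × Above c v
trailing-block [] _ _ = 0 , [] , refl , []
trailing-block {c} (x ∷ r) (c≤x ∷ r≥c) avoid
  with c ≟ x | trailing-block r r≥c (λ c<y τ → avoid c<y (x ∷ʳ τ))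
... | no c≢x   | m , v , eq , v>c = m , x ∷ v , cong (x ∷_) eq , ≤∧≢⇒< c≤x c≢x ∷ v>c
... | yes refl | m , [] , eq , v>c = suc m , [] , cong (c ∷_) eq , []
... | yes refl | m , y ∷ v , refl , c<y ∷ v>c =
  contradiction (refl ∷ refl ∷ minimum _) (avoid c<y)

shape121 : Shape
shape121 = record
  { γ′           = true ∷ false ∷ []
  ; tail         = λ c m v → replicate m c ++ v
  ; true∈γ′      = here refl
  ; tail-zero    = λ _ _ → refl
  ; tail-[]      = λ c m → ++-identityʳ _
  ; strip-tail   = λ {c} m {v} v>c →
      trans (filter-++ (c <?_) (replicate m c) v) (cong₂ _++_ (strip-replicate c m) (strip-above v>c))
  ; tail-atLeast = λ m v>c → All.++⁺ (All.replicate⁺ m ≤-refl) (weaken v>c)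
  ; occ-tail     = λ {c} m {v} v>c → trans (occ-++ c (replicate m c) v)
      (trans (cong₂ _+_ (occ-replicate c m) (occ-above v>c)) (+-identityʳ m))
  ; ¬sct⊆tail    = λ m v>c c<s c<t τ →
      c∷σ⊈above v>c (∷-⊆⇒⊆ (⊆-skip-replicate m c<s τ))
  ; ¬γ⊆tail      = λ m v>c c<y τ →
      c∷σ⊈above v>c (∷-⊆⇒⊆ (⊆-skip-replicate m c<y (∷-⊆-∷ τ)))
  ; decompose    = λ {c} {r} r≥c avoid → leading-block r r≥c λ c<y τ → avoid c<y (refl ∷ τ)
  }

shape112 : Shape
shape112 = record
  { γ′           = false ∷ true ∷ []
  ; tail         = λ c m v → v ++ replicate m c
  ; true∈γ′      = there (here refl)
  ; tail-zero    = λ c v → ++-identityʳ v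
  ; tail-[]      = λ _ _ → refl
  ; strip-tail   = λ {c} m {v} v>c →
      trans (filter-++ (c <?_) v (replicate m c))
            (trans (cong₂ _++_ (strip-above v>c) (strip-replicate c m)) (++-identityʳ v))
  ; tail-atLeast = λ m v>c → All.++⁺ (weaken v>c) (All.replicate⁺ m ≤-refl)
  ; occ-tail     = λ {c} m {v} v>c → trans (occ-++ c v (replicate m c))
      (cong₂ _+_ (occ-above v>c) (occ-replicate c m))
  ; ¬sct⊆tail    = λ m v>c c<s c<t τ → cy⊈ m v>c c<t (∷-⊆⇒⊆ τ)
  ; ¬γ⊆tail      = λ m v>c c<y τ → cy⊈ m v>c c<y (∷-⊆-∷ τ)
  ; decompose    = λ {c} {r} r≥c avoid → trailing-block r r≥c λ c<y τ → avoid c<y (refl ∷ τ)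
  }
  where
  cy⊈ : ∀ {c y} m {v} → Above c v → c < y → ¬ (c ∷ y ∷ [] ⊆ v ++ replicate m c)
  cy⊈ m v>c c<y τ = contradiction
    (∷-⊆-replicate m (∷-⊆⇒⊆ (⊆-skip (∉-above v>c) τ))) (>⇒≢ c<y)

-- Instances of the patterns

map-inst : ∀ (h : ℕ → ℕ) β x y → map h (inst β x y) ≡ inst β (h x) (h y)
map-inst h []          x y = refl
map-inst h (false ∷ β) x y = cong (h x ∷_) (map-inst h β x y)
map-inst h (true  ∷ β) x y = cong (h y ∷_) (map-inst h β x y)

inst-++ : ∀ α β x y → inst (α ++ β) x y ≡ inst α x y ++ inst β x y
inst-++ α β x y = map-++ (λ b → if b then y else x) α β

All-inst : ∀ {P : ℕ → Set} β {x y} → P x → P y → All P (inst β x y)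
All-inst []          px py = []
All-inst (false ∷ β) px py = px ∷ All-inst β px py
All-inst (true  ∷ β) px py = py ∷ All-inst β px py

⊆-inst : ∀ {α β} x y → α ⊆ β → inst α x y ⊆ inst β x y
⊆-inst x y = map⁺ (λ b → if b then y else x)

assign : ℕ → ℕ → ℕ → ℕ → ℕ
assign x y z 1 = x
assign x y z 2 = y
assign x y z _ = z

OneToThree : ℕ → Set
OneToThree a = a ≡ 1 ⊎ a ≡ 2 ⊎ a ≡ 3

assign-mono : ∀ {x y z a b} → x < y → y < z → OneToThree a → OneToThree b →
              a < b → assign x y z a < assign x y z b
assign-mono x<y y<z (inj₁ refl)        (inj₁ refl)        (s≤s ())
assign-mono x<y y<z (inj₁ refl)        (inj₂ (inj₁ refl)) _ = x<y
assign-mono x<y y<z (inj₁ refl)        (inj₂ (inj₂ refl)) _ = <-trans x<y y<z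
assign-mono x<y y<z (inj₂ (inj₁ refl)) (inj₁ refl)        (s≤s ())
assign-mono x<y y<z (inj₂ (inj₁ refl)) (inj₂ (inj₁ refl)) (s≤s (s≤s ()))
assign-mono x<y y<z (inj₂ (inj₁ refl)) (inj₂ (inj₂ refl)) _ = y<z
assign-mono x<y y<z (inj₂ (inj₂ refl)) (inj₁ refl)        (s≤s ())
assign-mono x<y y<z (inj₂ (inj₂ refl)) (inj₂ (inj₁ refl)) (s≤s (s≤s ()))
assign-mono x<y y<z (inj₂ (inj₂ refl)) (inj₂ (inj₂ refl)) a<a = contradiction a<a (n≮n _)

-- Sizes in the generating tree, and lists without repetition

-- The argument m stands for the multiplicity m + 1, as in ins.
childSizes : ℕ → ℕ → List ℕ
childSizes zero    n = replicate (suc n) (suc n)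
childSizes (suc m) n = (suc (suc m) + n) ∷ map (2 +_) (upTo n)

map-const : ∀ {A : Set} {f : A → ℕ} {n} xs → All (λ x → f x ≡ n) xs →
            map f xs ≡ replicate (length xs) n
map-const []       []         = refl
map-const (x ∷ xs) (eq ∷ eqs) = cong₂ _∷_ eq (map-const xs eqs)

module _ {A B : Set} (f : A → List B) where

  concatMap-↭ : ∀ {xs ys} → xs ↭ ys → concatMap f xs ↭ concatMap f ys
  concatMap-↭ _↭_.refl        = ↭-refl
  concatMap-↭ (prep x p)      = Perm.++⁺ˡ (f x) (concatMap-↭ p)
  concatMap-↭ {x ∷ y ∷ xs} {_ ∷ _ ∷ ys} (_↭_.swap x y p) = begin
    f x ++ f y ++ concatMap f xs   ≡⟨ ++-assoc (f x) (f y) _ ⟨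
    (f x ++ f y) ++ concatMap f xs ↭⟨ Perm.++⁺ (Perm.++-comm (f x) (f y)) (concatMap-↭ p) ⟩
    (f y ++ f x) ++ concatMap f ys ≡⟨ ++-assoc (f y) (f x) _ ⟩
    f y ++ f x ++ concatMap f ys   ∎
    where open PermutationReasoning
  concatMap-↭ (_↭_.trans p q) = ↭-trans (concatMap-↭ p) (concatMap-↭ q)

  unique-concatMap : ∀ {xs} → Unique xs → (∀ {x} → x ∈ xs → Unique (f x)) →
                     (∀ {x y z} → x ∈ xs → y ∈ xs → z ∈ f x → z ∈ f y → x ≡ y) →
                     Unique (concatMap f xs)
  unique-concatMap {[]} _ _ _ = AllPairs.[]
  unique-concatMap {x ∷ xs} (x∉xs AllPairs.∷ xs!) f! origin = Unique.++⁺ (f! (here refl))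
    (unique-concatMap xs! (f! ∘ there) (λ x∈ y∈ → origin (there x∈) (there y∈)))
    λ (z∈fx , z∈rest) → let y , y∈xs , z∈fy = find (∈-concatMap⁻ f {xs = xs} z∈rest) in
      All.lookup x∉xs y∈xs (origin (here refl) (there y∈xs) z∈fx z∈fy)

unique-map : ∀ {A B : Set} (f : A → B) {xs} → Unique xs →
             (∀ {x y} → x ∈ xs → y ∈ xs → f x ≡ f y → x ≡ y) → Unique (map f xs)
unique-map f AllPairs.[] inj = AllPairs.[]
unique-map f (x∉xs AllPairs.∷ xs!) inj =
  All.map⁺ (All.tabulate λ y∈xs fx≡fy → All.lookup x∉xs y∈xs (inj (here refl) (there y∈xs) fx≡fy))
  AllPairs.∷ unique-map f xs! (λ x∈ y∈ → inj (there x∈) (there y∈))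

sites-unique : ∀ A w → Unique (sites A w)
sites-unique A [] = AllPairs.[]
sites-unique A (x ∷ w) with A [] (x ∷ w)
... | true  = All.map⁺ (All.tabulate (λ _ ())) AllPairs.∷ rest
  where rest = Unique.map⁺ (λ { refl → refl }) (sites-unique (A ∘ (x ∷_)) w)
... | false = Unique.map⁺ (λ { refl → refl }) (sites-unique (A ∘ (x ∷_)) w)

∈-occ : ∀ {x} w → 1 ≤ occ x w → x ∈ w
∈-occ {x} (y ∷ w) 1≤ with x ≟ y
... | yes x≡y = here x≡y
... | no x≢y  = there (∈-occ w (subst (1 ≤_) (occ-∷-≢ w x≢y) 1≤))

-- The root of the tree is the empty word; its only place is the end, which sizes leave out, hence
-- the 0.
sizeLevel : ∀ {k} → (Fin k → ℕ) → List ℕ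
sizeLevel {zero}  mult = 0 ∷ []
sizeLevel {suc k} mult = concatMap (childSizes (pred (mult zero))) (sizeLevel (mult ∘ suc))

first-occurrence-injective : ∀ {c r r′} u u′ → Above c u → Above c u′ →
                             u ++ c ∷ r ≡ u′ ++ c ∷ r′ → u ≡ u′ × r ≡ r′
first-occurrence-injective []      []       _ _ refl = refl , refl
first-occurrence-injective []      (_ ∷ u′) _ (c<c ∷ _) refl = contradiction c<c (n≮n _)
first-occurrence-injective (_ ∷ u) []       (c<c ∷ _) _ refl = contradiction c<c (n≮n _)
first-occurrence-injective (x ∷ u) (y ∷ u′) (_ ∷ u>c) (_ ∷ u′>c) eq
  with refl , eq′ ← ∷-injective eq =
  map₁ (cong (x ∷_)) (first-occurrence-injective u u′ u>c u′>c eq′)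

-- A record, so that comparing two such types does not unfold the enumeration behind av.
record CountedByLevel (P : List Word) : Set where
  constructor countedByLevel
  field av≡ : ∀ S → av S P ≡ length (sizeLevel (Multiset.mult S))

countedByLevel⇒∼ : ∀ P Q → CountedByLevel P → CountedByLevel Q → P ∼ Q
countedByLevel⇒∼ P Q (countedByLevel p) (countedByLevel q) S = trans (p S) (sym (q S))

-- The generating tree of a pair of patterns

module Scheme
  (shape : Shape) (α : List Bool) (b : Bool) (β′ : List Bool)
  -- A lone copy of c cannot be the letter that α β repeats. By the next assumption, both letters of
  -- a configuration occur in the word, and a larger letter must follow the smaller one. Writing β
  -- as b ∷ β′ makes it nonempty, which is why the end is always allowed.
  (11⊆αβ : false ∷ false ∷ [] ⊆ α ++ b ∷ β′)
  (12⊆αβ : false ∷ true ∷ [] ⊆ α ++ b ∷ β′)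
  where

  open Shape shape

  β : List Bool
  β = b ∷ β′

  ρ₃ ρ₄ : Word
  ρ₃ = inst γ 1 2
  ρ₄ = inst α 2 3 ++ 1 ∷ inst β 2 3

  Good : Word → Set
  Good = AvoidsAll (ρ₃ ∷ ρ₄ ∷ [])

  Has₃ Has₄ : Word → Set
  Has₃ π = ∃₂ λ x y → x < y × inst γ x y ⊆ π
  Has₄ π = ∃ λ x → ∃₂ λ y z → x < y × y < z × inst α y z ++ x ∷ inst β y z ⊆ π

  ρ₃-letters : All OneToThree ρ₃
  ρ₃-letters = All-inst γ (inj₁ refl) (inj₂ (inj₁ refl))

  ρ₄-letters : All OneToThree ρ₄
  ρ₄-letters = All.++⁺ (All-inst α (inj₂ (inj₁ refl)) (inj₂ (inj₂ refl)))
    (inj₁ refl ∷ All-inst β (inj₂ (inj₁ refl)) (inj₂ (inj₂ refl)))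

  map-ρ₄ : ∀ h → map h ρ₄ ≡ inst α (h 2) (h 3) ++ h 1 ∷ inst β (h 2) (h 3)
  map-ρ₄ h = trans (map-++ h (inst α 2 3) _)
    (cong₂ (λ σ τ → σ ++ h 1 ∷ τ) (map-inst h α 2 3) (map-inst h β 2 3))

  contains₃⇔ : ∀ {π} → Contains π ρ₃ ⇔ Has₃ π
  contains₃⇔ {π} = mk⇔
    (λ occurs → let h , mono , τ = contains⇒matches {π} {ρ₃} occurs in
      h 1 , h 2 , mono (here refl) (there (∈-map⁺ (λ b → if b then 2 else 1) true∈γ′)) (n<1+n 1) ,
      subst (_⊆ π) (map-inst h γ 1 2) τ)
    (λ (x , y , x<y , τ) → matches⇒contains {π} {ρ₃}
      -- The letter 3 does not occur in `ρ₃`; `suc y` is just some value above y.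
      (assign x y (suc y) ,
       (λ a∈ b∈ → assign-mono x<y (n<1+n y) (All.lookup ρ₃-letters a∈) (All.lookup ρ₃-letters b∈)) ,
       subst (_⊆ π) (sym (map-inst (assign x y (suc y)) γ 1 2)) τ))

  23⊆ρ₄ : 2 ∷ 3 ∷ [] ⊆ ρ₄
  23⊆ρ₄ = ⊆-trans (⊆-inst 2 3 12⊆αβ)
    (⊆-trans (⊆-reflexive (inst-++ α β 2 3)) (++⁺ {as = inst α 2 3} ⊆-refl (1 ∷ʳ ⊆-refl)))

  1∈ρ₄ : 1 ∈ ρ₄
  1∈ρ₄ = to∈ {as = []} (++⁺ˡ (inst α 2 3) (refl ∷ minimum _))

  contains₄⇔ : ∀ {π} → Contains π ρ₄ ⇔ Has₄ π
  contains₄⇔ {π} = mk⇔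
    (λ occurs → let h , mono , τ = contains⇒matches {π} {ρ₄} occurs in
      h 1 , h 2 , h 3 , mono 1∈ρ₄ (to∈ 23⊆ρ₄) (n<1+n 1) ,
      mono (to∈ 23⊆ρ₄) (to∈ (∷-⊆⇒⊆ 23⊆ρ₄)) (n<1+n 2) ,
      subst (_⊆ π) (map-ρ₄ h) τ)
    (λ (x , y , z , x<y , y<z , τ) → matches⇒contains {π} {ρ₄}
      (assign x y z ,
       (λ a∈ b∈ → assign-mono x<y y<z (All.lookup ρ₄-letters a∈) (All.lookup ρ₄-letters b∈)) ,
       subst (_⊆ π) (sym (map-ρ₄ (assign x y z))) τ))

  good⇒ : ∀ {π} → Good π → ¬ Has₃ π × ¬ Has₄ π
  good⇒ (a₃ ∷ a₄ ∷ []) = a₃ ∘ Equivalence.from contains₃⇔ , a₄ ∘ Equivalence.from contains₄⇔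

  good⇐ : ∀ {π} → ¬ Has₃ π → ¬ Has₄ π → Good π
  good⇐ {π} a₃ a₄ =
    (a₃ ∘ Equivalence.to (contains₃⇔ {π})) ∷ (a₄ ∘ Equivalence.to (contains₄⇔ {π})) ∷ []

  good-[] : Good []
  good-[] = good⇐ (λ { (_ , _ , _ , ()) }) no₄
    where
    no₄ : ¬ Has₄ []
    no₄ (x , y , z , _ , _ , τ)
      with () ← ⊆-trans (++⁺ˡ (inst α y z) (refl {x = x} ∷ minimum (inst β y z))) τ

  Bad : Word → Word → Set
  Bad u v = ∃₂ λ x y → x < y × inst α x y ⊆ u × inst β x y ⊆ v

  inst-⊆-++ : ∀ {σ x y u v} → σ ⊆ α ++ β → inst α x y ⊆ u → inst β x y ⊆ v → inst σ x y ⊆ u ++ v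
  inst-⊆-++ {x = x} {y} σ⊆ τ₁ τ₂ =
    ⊆-trans (⊆-inst x y σ⊆) (⊆-trans (⊆-reflexive (inst-++ α β x y)) (++⁺ τ₁ τ₂))

  -- Both letters of a configuration occur in u ++ v by `12⊆αβ`, so a finite search suffices.
  bad? : ∀ u v → Dec (Bad u v)
  bad? u v = map′
    (λ any → map₂ satisfied (satisfied any))
    (λ (x , y , x<y , τ₁ , τ₂) → let xy⊆ = inst-⊆-++ {σ = false ∷ true ∷ []} 12⊆αβ τ₁ τ₂ in
      lose (to∈ xy⊆) (lose (to∈ (∷-⊆⇒⊆ xy⊆)) (x<y , τ₁ , τ₂)))
    (any? (λ x → any? (λ y → (x <? y) ×-dec (inst α x y ⊆? u) ×-dec (inst β x y ⊆? v))
                      (u ++ v))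
          (u ++ v))

  active : SplitTest
  active u v = does (¬? (bad? u v))

  ¬bad⇒active : ∀ {u v} → ¬ Bad u v → active u v ≡ true
  ¬bad⇒active ¬b = dec-true (¬? (bad? _ _)) ¬b

  bad⇒¬active : ∀ {u v} → Bad u v → active u v ≡ false
  bad⇒¬active b = dec-false (¬? (bad? _ _)) (λ ¬b → ¬b b)

  active⇒¬bad : ∀ {u v} → active u v ≡ true → ¬ Bad u v
  active⇒¬bad act b with () ← trans (sym act) (bad⇒¬active b)

  active-cong : ∀ {u v u′ v′} → (Bad u v → Bad u′ v′) → (Bad u′ v′ → Bad u v) →
                active u v ≡ active u′ v′
  active-cong f g = cong not (does-⇔ (mk⇔ f g) (bad? _ _) (bad? _ _))

  active-end : ∀ u → active u [] ≡ true
  active-end u = ¬bad⇒active {u} {[]} λ { (_ , _ , _ , _ , ()) }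

  -- No forbidden configuration at p | q has c as its smaller letter.
  MinFree : ℕ → Word → Word → Set
  MinFree c p q = ∀ {y} → c < y → inst α c y ⊆ p → inst β c y ⊆ q → ⊥

  -- The smaller letter is at least c, and `MinFree` rules out equality. Both letters then exceed c
  -- and survive the deletion.
  bad-strip : ∀ {c p q} → AtLeast c p → AtLeast c q → MinFree c p q → Bad p q →
              Bad (strip c p) (strip c q)
  bad-strip {c} p≥c q≥c free (x , y , x<y , τ₁ , τ₂)
    with c≤x ∷ _ ← All-resp-⊆ (inst-⊆-++ {σ = false ∷ true ∷ []} 12⊆αβ τ₁ τ₂) (All.++⁺ p≥c q≥c)
    with c ≟ x
  ... | yes refl = ⊥-elim (free x<y τ₁ τ₂)
  ... | no c≢x = x , y , x<y , ⊆-strip (All-inst α c<x c<y) τ₁ , ⊆-strip (All-inst β c<x c<y) τ₂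
    where
    c<x = ≤∧≢⇒< c≤x c≢x
    c<y = <-trans c<x x<y

  bad-mono : ∀ {u v u′ v′} → u ⊆ u′ → v ⊆ v′ → Bad u v → Bad u′ v′
  bad-mono σ₁ σ₂ (x , y , x<y , τ₁ , τ₂) = x , y , x<y , ⊆-trans τ₁ σ₁ , ⊆-trans τ₂ σ₂

  active-strip : ∀ {c p q} → AtLeast c p → AtLeast c q → MinFree c p q →
                 active p q ≡ active (strip c p) (strip c q)
  active-strip p≥c q≥c free =
    active-cong (bad-strip p≥c q≥c free) (bad-mono (filter-⊆ _ _) (filter-⊆ _ _))

  good-⊆ : ∀ {σ π} → σ ⊆ π → Good π → Good σ
  good-⊆ σ⊆π good = let ¬3 , ¬4 = good⇒ good in
    good⇐ (λ (x , y , x<y , τ) → ¬3 (x , y , x<y , ⊆-trans τ σ⊆π))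
          (λ (x , y , z , x<y , y<z , τ) → ¬4 (x , y , z , x<y , y<z , ⊆-trans τ σ⊆π))

  module _ {c u v} (m : ℕ) (u>c : Above c u) (v>c : Above c v) where

    ins-atLeast : AtLeast c (ins c m u v)
    ins-atLeast = All.++⁺ (weaken u>c) (≤-refl ∷ tail-atLeast m v>c)

    strip-ins : strip c (ins c m u v) ≡ u ++ v
    strip-ins = trans (strip-++-∷ _ u>c) (cong (u ++_) (strip-tail m v>c))

    occ-ins : occ c (ins c m u v) ≡ suc m
    occ-ins = trans (occ-++ c u _) (trans (cong (_+ _) (occ-above u>c))
              (trans (occ-∷-≡ c _) (cong suc (occ-tail m v>c))))

    -- A new occurrence must use c, and as its smallest letter. For `ρ₃` the shape excludes this.
    -- For `ρ₄`, `cut` either puts α inside u, so that β lies in v and the place was forbidden, or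
    -- finds s c t in the tail, which the shape excludes too.
    ins-good : Good (u ++ v) → active u v ≡ true → Good (ins c m u v)
    ins-good good act = good⇐ no₃ no₄
      where
      no₃ : ¬ Has₃ (ins c m u v)
      no₃ (x , y , x<y , τ) with c≤x ∷ _ ← All-resp-⊆ τ ins-atLeast with c ≟ x
      ... | yes refl = ¬γ⊆tail m v>c x<y (⊆-skip (∉-above u>c) τ)
      ... | no c≢x = proj₁ (good⇒ good) (x , y , x<y , subst (inst γ x y ⊆_) strip-ins
                       (⊆-strip (All-inst γ c<x (<-trans c<x x<y)) τ))
        where c<x = ≤∧≢⇒< c≤x c≢x

      no₄ : ¬ Has₄ (ins c m u v)
      no₄ (x , y , z , x<y , y<z , τ)
        with c≤x ∷ _ ← All.++⁻ʳ (inst α y z) (All-resp-⊆ τ ins-atLeast) with c ≟ x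
      ... | yes refl with cut u (All-inst α x<y (<-trans x<y y<z)) τ
      ...   | inj₂ (s , c<s , τ′) =
              ¬sct⊆tail m v>c c<s (All.head (All-inst {x <_} β x<y (<-trans x<y y<z)))
                        (⊆-trans (refl ∷ refl ∷ refl ∷ minimum _) τ′)
      ...   | inj₁ τ₁ = active⇒¬bad act
              (y , z , y<z , τ₁ , subst (inst β y z ⊆_) (strip-tail m v>c)
                (⊆-strip (All-inst β x<y (<-trans x<y y<z))
                  (∷-⊆-∷ (⊆-skip (∉-above u>c) (⊆-trans (++⁺ˡ (inst α y z) ⊆-refl) τ)))))
      no₄ (x , y , z , x<y , y<z , τ) | no c≢x =
        proj₂ (good⇒ good) (x , y , z , x<y , y<z , subst (inst α y z ++ x ∷ inst β y z ⊆_) strip-ins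
          (⊆-strip (All.++⁺ (All-inst α c<y c<z) (c<x ∷ All-inst β c<y c<z)) τ))
        where
        c<x = ≤∧≢⇒< c≤x c≢x
        c<y = <-trans c<x x<y
        c<z = <-trans c<y y<z

    ins-good⁻ : Good (ins c m u v) → Good (u ++ v) × active u v ≡ true
    ins-good⁻ good = good-⊆ (subst (_⊆ ins c m u v) strip-ins (filter-⊆ _ _)) good ,
      ¬bad⇒active λ (y , z , y<z , τ₁ , τ₂) → proj₂ (good⇒ good)
        (c , y , z ,
         All.head (All-resp-⊆ (inst-⊆-++ {σ = false ∷ true ∷ []} 12⊆αβ τ₁ τ₂) (All.++⁺ u>c v>c)) ,
         y<z , ++⁺ τ₁ (refl ∷ ⊆-trans τ₂ (subst (_⊆ tail c m v) (strip-tail m v>c) (filter-⊆ _ _))))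

  good-decompose : ∀ {c π} → AtLeast c π → c ∈ π → Good π →
                   ∃ λ m → ∃₂ λ u v → π ≡ ins c m u v × Above c u × Above c v
  good-decompose π≥c c∈π good
    with u , r , refl , u>c , r≥c ← first-split π≥c c∈π
    with m , v , refl , v>c ← decompose r≥c (λ c<y τ → proj₁ (good⇒ good) (_ , _ , c<y , ++⁺ˡ u τ))
    = m , u , v , refl , u>c , v>c

  -- The numbers of allowed places

  size : Word → ℕ
  size = count active

  length-sites : ∀ w → length (sites active w) ≡ size w
  length-sites w = trans (sym (length-map (uncurry (before active)) (sites active w)))
    (trans (cong length (sites-before active w)) (length-upTo (size w)))

  size-split : ∀ u c v → size (u ++ c ∷ v) ≡
    before active u (c ∷ v) + (indicator (active u (c ∷ v)) + after active (u ++ c ∷ []) v)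
  size-split u c v =
    trans (count-++ active u (c ∷ v)) (cong (before active u (c ∷ v) +_) (after-∷ active u c v))

  module _ {c u v} (u>c : Above c u) (v>c : Above c v) where

    c∷c⊈single : ∀ {y} → ¬ (inst (α ++ β) c y ⊆ u ++ c ∷ v)
    c∷c⊈single {y} τ =
      c∷σ⊈above v>c (∷-⊆-∷ (⊆-skip (∉-above u>c) (⊆-trans (⊆-inst c y 11⊆αβ) τ)))

    minFree-single : ∀ {p q} → p ++ q ≡ u ++ c ∷ v → MinFree c p q
    minFree-single eq _ τ₁ τ₂ = c∷c⊈single (subst (_ ⊆_) eq (inst-⊆-++ ⊆-refl τ₁ τ₂))

    active-single : active u (c ∷ v) ≡ active u v
    active-single = trans
      (active-strip (weaken u>c) (≤-refl ∷ weaken v>c) (minFree-single refl))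
      (cong₂ active (strip-above u>c) (trans (strip-∷ c v) (strip-above v>c)))

    -- The place u | v splits into one in front of c and one behind it, both with its status; all
    -- other places keep theirs.
    size-single : active u v ≡ true → size (u ++ c ∷ v) ≡ suc (size (u ++ v))
    size-single act = begin
      size (u ++ c ∷ v) ≡⟨ size-split u c v ⟩
      before active u (c ∷ v) + (indicator (active u (c ∷ v)) + after active (u ++ c ∷ []) v)
        ≡⟨ cong₂ _+_ before≡ (cong₂ _+_ (cong indicator (trans active-single act)) after≡) ⟩
      before active u v + suc (after active u v) ≡⟨ +-suc _ _ ⟩
      suc (before active u v + after active u v) ≡⟨ cong suc (count-++ active u v) ⟨
      suc (size (u ++ v)) ∎
      where
      open ≡-Reasoning
      before≡ : before active u (c ∷ v) ≡ before active u v
      before≡ = count-cong u λ { p x q refl →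
        let p>c , q>c = All.++⁻ p u>c in trans
        (active-strip (weaken p>c) (All.++⁺ (weaken q>c) (≤-refl ∷ weaken v>c))
                      (minFree-single (sym (++-assoc p (x ∷ q) (c ∷ v)))))
        (cong₂ active (strip-above p>c)
          (trans (strip-++-∷ v q>c) (cong ((x ∷ q) ++_) (strip-above v>c)))) }
      after≡ : after active (u ++ c ∷ []) v ≡ after active u v
      after≡ = count-cong v λ { p x q refl →
        let p>c , q>c = All.++⁻ p v>c
            eq = ++-assoc u (c ∷ []) p in trans
        (active-strip (subst (AtLeast c) (sym eq) (All.++⁺ (weaken u>c) (≤-refl ∷ weaken p>c)))
                      (weaken q>c)
                      (minFree-single (trans (cong (_++ x ∷ q) eq) (++-assoc u (c ∷ p) (x ∷ q)))))
        (cong₂ active (trans (cong (strip c) eq)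
                             (trans (strip-++-∷ p u>c) (cong (u ++_) (strip-above p>c))))
                      (strip-above q>c)) }

  -- Nothing larger follows a copy of c, so no configuration has c as its smaller letter. In front
  -- of each copy, deleting the c's leaves an empty right-hand side, which is always allowed.
  size-end : ∀ {c u} m → Above c u → size (u ++ replicate m c) ≡ m + size u
  size-end {c} {u} m u>c = begin
    size (u ++ replicate m c) ≡⟨ count-++ active u (replicate m c) ⟩
    before active u (replicate m c) + after active u (replicate m c) ≡⟨ cong₂ _+_ before≡ after≡ ⟩
    size u + m ≡⟨ +-comm (size u) m ⟩
    m + size u ∎
    where
    open ≡-Reasoning
    W≥c : AtLeast c (u ++ replicate m c)
    W≥c = All.++⁺ (weaken u>c) (All.replicate⁺ m ≤-refl)
    free : ∀ {p q} → p ++ q ≡ u ++ replicate m c → MinFree c p q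
    free eq c<y τ₁ τ₂ = contradiction
      (∷-⊆-replicate m (∷-⊆⇒⊆ (⊆-skip (∉-above u>c)
        (subst (_ ⊆_) eq (inst-⊆-++ {σ = false ∷ true ∷ []} 12⊆αβ τ₁ τ₂)))))
      (>⇒≢ c<y)
    atLeast : ∀ p {q} → p ++ q ≡ u ++ replicate m c → AtLeast c p × AtLeast c q
    atLeast p eq = All.++⁻ p (subst (AtLeast c) (sym eq) W≥c)
    before≡ : before active u (replicate m c) ≡ size u
    before≡ = count-cong u λ { p x q refl →
      let p>c , q>c = All.++⁻ p u>c
          eq = sym (++-assoc p (x ∷ q) (replicate m c))
          p≥c , q≥c = atLeast p eq in trans
      (active-strip p≥c q≥c (free eq))
      (cong₂ active (strip-above p>c)
        (trans (filter-++ (c <?_) (x ∷ q) (replicate m c))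
        (trans (cong₂ _++_ (strip-above q>c) (strip-replicate c m)) (++-identityʳ _)))) }
    after≡ : after active u (replicate m c) ≡ m
    after≡ = trans (count-cong (replicate m c) λ p x q eq →
      let whole = trans (++-assoc u p (x ∷ q)) (cong (u ++_) eq)
          p≥c , q≥c = atLeast (u ++ p) whole
          q⊆ = subst (x ∷ q ⊆_) eq (++⁺ˡ p ⊆-refl)
          stripped = trans (active-strip p≥c q≥c (free whole))
                           (cong (active (strip c (u ++ p))) (filter-none (c <?_)
                             (All.map ≤⇒≯ (All-resp-⊆ q⊆ (All.replicate⁺ m ≤-refl)))))
      in trans stripped (active-end (strip c (u ++ p))))
      (trans (count-true (replicate m c)) (length-replicate m))

  children : ℕ → ℕ → Word → List Word
  children c m w = map (uncurry (ins c m)) ((w , []) ∷ sites active w)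

  -- The one count for which the pairs need different arguments: multiplicity m + 2, inserted
  -- anywhere but at the end.
  SiteSizes : Set
  SiteSizes = ∀ c m {w} → Above c w →
    map (size ∘ uncurry (ins c (suc m))) (sites active w) ↭ map (2 +_) (upTo (size w))

  size-ins-end : ∀ {c w} m → Above c w → size (ins c m w []) ≡ suc m + size w
  size-ins-end {c} {w} m w>c =
    trans (cong (λ t → size (w ++ c ∷ t)) (tail-[] c m)) (size-end (suc m) w>c)

  children-sizes : SiteSizes → ∀ {c w} m → Above c w →
                   map size (children c m w) ↭ childSizes m (size w)
  children-sizes _ {c} {w} zero w>c = ↭-reflexive (cong₂ _∷_ (size-ins-end 0 w>c) (begin
    map size (map (uncurry (ins c 0)) (sites active w)) ≡⟨ map-∘ (sites active w) ⟨
    map (size ∘ uncurry (ins c 0)) (sites active w)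
      ≡⟨ map-const (sites active w) (All.map (λ { {u , v} (refl , _ , act) →
           let u>c , v>c = All.++⁻ u w>c in
           trans (cong (λ t → size (u ++ c ∷ t)) (tail-zero c v)) (size-single u>c v>c act) })
         (sites-sound active w)) ⟩
    replicate (length (sites active w)) (suc (size w))
      ≡⟨ cong (λ n → replicate n (suc (size w))) (length-sites w) ⟩
    replicate (size w) (suc (size w)) ∎))
    where open ≡-Reasoning
  children-sizes siteSizes {c} {w} (suc m) w>c = ↭-trans
    (↭-reflexive (cong₂ _∷_ (size-ins-end (suc m) w>c) (sym (map-∘ (sites active w)))))
    (prep _ (siteSizes c m w>c))

  -- Two or more copies of c keep the sites to their left, and add only the places in front of the
  -- first copy and in front of the letter after it.
  module BeforeRanked
    -- Up to directly behind the first c, α with c as its smaller letter is still incomplete; one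
    -- letter further, the second assumption finds a whole configuration.
    (minFree-left : ∀ {c u y} → Above c u → c < y → ¬ (inst α c y ⊆ u ++ c ∷ []))
    (tail-blocked : ∀ {c v} m → Above c v → v ≢ [] → ∃₂ λ h t → tail c (suc m) v ≡ h ∷ t ×
                    (∀ u p x q → p ++ x ∷ q ≡ t → Bad (u ++ c ∷ h ∷ p) (x ∷ q)))
    where

    size-ins : ∀ {c u v} m → Above c u → Above c v → v ≢ [] → active u v ≡ true →
               size (ins c (suc m) u v) ≡ 2 + before active u v
    size-ins {c} {u} {v} m u>c v>c v≢[] act
      with h , t , tail≡ , blocked ← tail-blocked m v>c v≢[] = begin
      size (u ++ c ∷ T) ≡⟨ size-split u c T ⟩
      before active u (c ∷ T) + (indicator (active u (c ∷ T)) + after active (u ++ c ∷ []) T)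
        ≡⟨ cong₂ _+_ before≡ (cong₂ _+_ (cong indicator c-active) after≡) ⟩
      before active u v + 2 ≡⟨ +-comm (before active u v) 2 ⟩
      2 + before active u v ∎
      where
      open ≡-Reasoning
      T = tail c (suc m) v
      T≥c : AtLeast c T
      T≥c = tail-atLeast (suc m) v>c
      strip-c∷T : strip c (c ∷ T) ≡ v
      strip-c∷T = trans (strip-∷ c T) (strip-tail (suc m) v>c)
      free : ∀ {p q} → Above c p → MinFree c p q
      free p>c c<y τ _ = minFree-left p>c c<y (++⁺ʳ (c ∷ []) τ)
      before≡ : before active u (c ∷ T) ≡ before active u v
      before≡ = count-cong u λ { p x q refl →
        let p>c , q>c = All.++⁻ p u>c in trans
        (active-strip (weaken p>c) (All.++⁺ (weaken q>c) (≤-refl ∷ T≥c)) (free p>c))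
        (cong₂ active (strip-above p>c)
          (trans (strip-++-∷ T q>c) (cong ((x ∷ q) ++_) (strip-tail (suc m) v>c)))) }
      c-active : active u (c ∷ T) ≡ true
      c-active = trans (active-strip (weaken u>c) (≤-refl ∷ T≥c) (free u>c))
                       (trans (cong₂ active (strip-above u>c) strip-c∷T) act)
      h-active : active (u ++ c ∷ []) T ≡ true
      h-active = trans
        (active-strip (All.++⁺ (weaken u>c) (≤-refl ∷ [])) T≥c λ c<y τ _ → minFree-left u>c c<y τ)
        (trans (cong₂ active (trans (strip-++-∷ [] u>c) (++-identityʳ u)) (strip-tail (suc m) v>c))
               act)
      after≡ : after active (u ++ c ∷ []) T ≡ 1
      after≡ = begin
        after active (u ++ c ∷ []) T ≡⟨ cong (after active (u ++ c ∷ [])) tail≡ ⟩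
        after active (u ++ c ∷ []) (h ∷ t) ≡⟨ after-∷ active (u ++ c ∷ []) h t ⟩
        indicator (active (u ++ c ∷ []) (h ∷ t)) + after active ((u ++ c ∷ []) ++ h ∷ []) t
          ≡⟨ cong₂ (λ b n → indicator b + n) (trans (cong (active (u ++ c ∷ [])) (sym tail≡)) h-active)
               (trans (count-cong t λ p x q eq → bad⇒¬active
                        (subst (λ s → Bad s (x ∷ q))
                               (sym (trans (++-assoc (u ++ c ∷ []) (h ∷ []) p) (++-assoc u (c ∷ []) (h ∷ p))))
                               (blocked u p x q eq)))
                      (count-false t)) ⟩
        1 ∎

    siteSizes : SiteSizes
    siteSizes c m {w} w>c = ↭-reflexive (begin
      map (size ∘ uncurry (ins c (suc m))) (sites active w)
        ≡⟨ map-cong-local (All.map (λ { {u , v} (refl , v≢[] , act) →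
             let u>c , v>c = All.++⁻ u w>c in size-ins m u>c v>c v≢[] act })
           (sites-sound active w)) ⟩
      map ((2 +_) ∘ uncurry (before active)) (sites active w) ≡⟨ map-∘ (sites active w) ⟩
      map (2 +_) (map (uncurry (before active)) (sites active w))
        ≡⟨ cong (map (2 +_)) (sites-before active w) ⟩
      map (2 +_) (upTo (size w)) ∎)
      where open ≡-Reasoning

  -- Two or more copies of c keep the sites to their right, and add only the place in front of the
  -- last copy.
  module AfterRanked
    (bad-∀left : ∀ {u u′ v} → Bad u v → Bad u′ v)
    (tail≡ : ∀ c m v → tail c m v ≡ replicate m c ++ v)
    (bad-ccy : ∀ {c y p q} → c < y → c ∷ c ∷ y ∷ [] ⊆ q → Bad p q)
    where

    after-∀left : ∀ u u′ v → after active u v ≡ after active u′ v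
    after-∀left u u′ v = count-cong v λ p x q _ →
      active-cong (bad-∀left {u′ = u′ ++ p}) (bad-∀left {u′ = u ++ p})

    -- In front of any copy but the last, c c y lies to the right. The last copy stands alone in
    -- front of v, so the place there has the status of u | v, as for a single insertion.
    after-block : ∀ {c u v} m → Above c u → Above c v → v ≢ [] → active u v ≡ true → ∀ u′ →
                  after active u′ (c ∷ replicate m c ++ v) ≡ suc (after active u v)
    after-block {c} {u} {v} zero u>c v>c v≢[] act u′ = trans (after-∷ active u′ c v)
      (cong₂ (λ b n → indicator b + n)
        (trans (active-cong {u′} {c ∷ v} {u} bad-∀left bad-∀left) (trans (active-single u>c v>c) act))
        (after-∀left (u′ ++ c ∷ []) u v))
    after-block {v = []} (suc m) u>c v>c v≢[] act u′ = contradiction refl v≢[]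
    after-block {c} {v = y ∷ v} (suc m) u>c (c<y ∷ v>c) v≢[] act u′ =
      trans (after-∷ active u′ c (c ∷ replicate m c ++ y ∷ v))
      (cong₂ (λ b n → indicator b + n)
        (bad⇒¬active {u′} (bad-ccy c<y (refl ∷ refl ∷ ++⁺ˡ (replicate m c) (refl ∷ minimum v))))
        (after-block m u>c (c<y ∷ v>c) v≢[] act (u′ ++ c ∷ [])))

    size-ins : ∀ {c u v} m → Above c u → Above c v → v ≢ [] → active u v ≡ true →
               size (ins c (suc m) u v) ≡ suc (after active u v)
    size-ins {v = []} m u>c v>c v≢[] act = contradiction refl v≢[]
    size-ins {c} {u} {v@(y ∷ v′)} m u>c v>c@(c<y ∷ _) v≢[] act = begin
      size (u ++ c ∷ tail c (suc m) v) ≡⟨ cong (λ t → size (u ++ c ∷ t)) (tail≡ c (suc m) v) ⟩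
      size (u ++ c ∷ c ∷ replicate m c ++ v) ≡⟨ count-++ active u _ ⟩
      before active u (c ∷ c ∷ replicate m c ++ v) + after active u (c ∷ c ∷ replicate m c ++ v)
        ≡⟨ cong₂ _+_
             (trans (count-cong u λ p x q _ → bad⇒¬active {p} (bad-ccy c<y
                       (++⁺ˡ (x ∷ q) (refl ∷ refl ∷ ++⁺ˡ (replicate m c) (refl ∷ minimum v′)))))
                    (count-false u))
             (after-block (suc m) u>c v>c v≢[] act u) ⟩
      suc (after active u v) ∎
      where open ≡-Reasoning

    siteSizes : SiteSizes
    siteSizes c m {w} w>c = ↭-trans (↭-reflexive (begin
      map (size ∘ uncurry (ins c (suc m))) (sites active w)
        ≡⟨ map-cong-local (All.map (λ { {u , v} (refl , v≢[] , act) →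
             let u>c , v>c = All.++⁻ u w>c in size-ins m u>c v>c v≢[] act })
           (sites-sound active w)) ⟩
      map (suc ∘ uncurry (after active)) (sites active w) ≡⟨ map-∘ (sites active w) ⟩
      map suc (map (uncurry (after active)) (sites active w)) ≡⟨ cong (map suc) (sites-after active w) ⟩
      map suc (map suc (downFrom (size w))) ≡⟨ map-∘ (downFrom (size w)) ⟨
      map (2 +_) (downFrom (size w)) ∎))
      -- Ranks from the right list the sizes in decreasing order.
      (Perm.map⁺ (2 +_) (↭-trans (↭-reflexive (sym (reverse-upTo (size w))))
                                 (Perm.↭-reverse (upTo (size w)))))
      where open ≡-Reasoning

  -- The tree lists every avoider exactly once

  module Enumeration (siteSizes : SiteSizes) where

    -- The letters are c + 1, …, c + k.
    enum : ∀ {k} → ℕ → (Fin k → ℕ) → List Word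
    enum {zero}  c mult = [] ∷ []
    enum {suc k} c mult = concatMap (children (suc c) (pred (mult zero))) (enum (suc c) (mult ∘ suc))

    -- For c = 0 this unfolds to `IsAvoider`. The offset c lets the induction drop the smallest
    -- letter without renaming the others.
    Spec : ∀ {k} → ℕ → (Fin k → ℕ) → Word → Set
    Spec {k} c mult π =
      ((∀ j → occ (suc (c + toℕ j)) π ≡ mult j) × All (λ x → c < x × x ≤ c + k) π) × Good π

    splits-sound : ∀ w → All (λ (u , v) → u ++ v ≡ w × active u v ≡ true) ((w , []) ∷ sites active w)
    splits-sound w =
      (++-identityʳ w , active-end w) ∷ All.map (λ (eq , _ , act) → eq , act) (sites-sound active w)

    ∈-children⁻ : ∀ {c m w π} → Above c w → π ∈ children c m w →
                  ∃₂ λ u v → u ++ v ≡ w × active u v ≡ true × Above c u × Above c v × π ≡ ins c m u v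
    ∈-children⁻ {c} {m} {w} w>c π∈ with (u , v) , uv∈ , refl ← ∈-map⁻ (uncurry (ins c m)) π∈
      with refl , act ← All.lookup (splits-sound w) uv∈ =
      u , v , refl , act , All.++⁻ˡ u w>c , All.++⁻ʳ u w>c , refl

    ∈-children⁺ : ∀ {c m} u v → active u v ≡ true → ins c m u v ∈ children c m (u ++ v)
    ∈-children⁺ u []      act rewrite ++-identityʳ u = here refl
    ∈-children⁺ {c} {m} u (x ∷ v) act = there (∈-map⁺ (uncurry (ins c m)) (∈-sites active u x v act))

    spec-above : ∀ {k} c (mult : Fin k → ℕ) {π} → Spec c mult π → Above c π
    spec-above c mult ((_ , bounds) , _) = All.map proj₁ bounds

    enum-sound : ∀ {k} c (mult : Fin k → ℕ) → (∀ j → 1 ≤ mult j) →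
                 ∀ {π} → π ∈ enum c mult → Spec c mult π
    enum-sound {zero}  c mult mult≥1 (here refl) = ((λ ()) , []) , good-[]
    enum-sound {suc k} c mult mult≥1 {π} π∈
      with w , w∈ , π∈w ← find (∈-concatMap⁻ (children (suc c) (pred (mult zero)))
                                            {xs = enum (suc c) (mult ∘ suc)} π∈)
      with spec@((occs , bounds) , good) ← enum-sound (suc c) (mult ∘ suc) (mult≥1 ∘ suc) w∈
      with u , v , refl , act , u>c , v>c , refl ← ∈-children⁻ (spec-above (suc c) (mult ∘ suc) spec) π∈w =
      (occs′ , bounds′) , ins-good m u>c v>c good act
      where
      m = pred (mult zero)
      occs′ : ∀ j → occ (suc (c + toℕ j)) (ins (suc c) m u v) ≡ mult j
      occs′ zero rewrite +-identityʳ c =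
        trans (occ-ins m u>c v>c) (suc-pred (mult zero) {{>-nonZero (mult≥1 zero)}})
      occs′ (suc j) rewrite +-suc c (toℕ j) = begin
        occ x (ins (suc c) m u v)
          ≡⟨ occ-strip (ins (suc c) m u v) (s≤s (s≤s (m≤m+n c (toℕ j)))) ⟨
        occ x (strip (suc c) (ins (suc c) m u v)) ≡⟨ cong (occ x) (strip-ins m u>c v>c) ⟩
        occ x (u ++ v)                            ≡⟨ occs j ⟩
        mult (suc j)                              ∎
        where
        open ≡-Reasoning
        x = suc (suc (c + toℕ j))
      bounds′ : All (λ x → c < x × x ≤ c + suc k) (ins (suc c) m u v)
      bounds′ = All-strip⁻ (ins-atLeast m u>c v>c)
        (≤-refl , subst (suc c ≤_) (sym (+-suc c k)) (s≤s (m≤m+n c k)))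
        (subst (All _) (sym (strip-ins m u>c v>c))
          (All.map (λ {x} (c<x , x≤) → <-trans (n<1+n c) c<x , subst (x ≤_) (sym (+-suc c k)) x≤)
                   bounds))

    enum-complete : ∀ {k} c (mult : Fin k → ℕ) → (∀ j → 1 ≤ mult j) →
                    ∀ {π} → Spec c mult π → π ∈ enum c mult
    enum-complete {zero} c mult mult≥1 {[]} _ = here refl
    enum-complete {zero} c mult mult≥1 {x ∷ π} ((_ , (c<x , x≤) ∷ _) , _) =
      contradiction (subst (x ≤_) (+-identityʳ c) x≤) (<⇒≱ c<x)
    enum-complete {suc k} c mult mult≥1 {π} ((occs , bounds) , good)
      with m , u , v , refl , u>c , v>c ← good-decompose {suc c} (All.map proj₁ bounds)
             (∈-occ π (subst (1 ≤_)
               (sym (trans (cong (λ i → occ (suc i) π) (sym (+-identityʳ c))) (occs zero)))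
               (mult≥1 zero)))
             good
      with good′ , act ← ins-good⁻ m u>c v>c good =
      ∈-concatMap⁺ (children (suc c) (pred (mult zero))) (lose uv∈
        (subst (λ m → ins (suc c) m u v ∈ children (suc c) (pred (mult zero)) (u ++ v)) (sym m≡)
               (∈-children⁺ u v act)))
      where
      m≡ : m ≡ pred (mult zero)
      m≡ = cong pred (trans (sym (occ-ins m u>c v>c))
             (trans (cong (λ i → occ (suc i) (ins (suc c) m u v)) (sym (+-identityʳ c))) (occs zero)))
      occs′ : ∀ j → occ (suc (suc c + toℕ j)) (u ++ v) ≡ mult (suc j)
      occs′ j = begin
        occ x (u ++ v)                            ≡⟨ cong (occ x) (strip-ins m u>c v>c) ⟨
        occ x (strip (suc c) (ins (suc c) m u v))
          ≡⟨ occ-strip (ins (suc c) m u v) (s≤s (s≤s (m≤m+n c (toℕ j)))) ⟩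
        occ x (ins (suc c) m u v)
          ≡⟨ cong (λ i → occ (suc i) (ins (suc c) m u v)) (sym (+-suc c (toℕ j))) ⟩
        occ (suc (c + toℕ (suc j))) (ins (suc c) m u v) ≡⟨ occs (suc j) ⟩
        mult (suc j)                              ∎
        where
        open ≡-Reasoning
        x = suc (suc c + toℕ j)
      bounds′ : All (λ x → suc c < x × x ≤ suc c + k) (u ++ v)
      bounds′ = All.zipWith (λ {x} (c<x , (_ , x≤)) → c<x , subst (x ≤_) (+-suc c k) x≤)
        (All.++⁺ u>c v>c , subst (All _) (strip-ins m u>c v>c) (All.filter⁺ (suc c <?_) bounds))
      uv∈ : u ++ v ∈ enum (suc c) (mult ∘ suc)
      uv∈ = enum-complete (suc c) (mult ∘ suc) (mult≥1 ∘ suc) ((occs′ , bounds′) , good′)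

    -- The first c marks the end of u, and deleting the c's from the rest returns v.
    ins-injective : ∀ {c u v u′ v′} m → Above c u → Above c v → Above c u′ → Above c v′ →
                    ins c m u v ≡ ins c m u′ v′ → (u , v) ≡ (u′ , v′)
    ins-injective {c} {u} {v} {u′} {v′} m u>c v>c u′>c v′>c eq
      with refl , tail≡ ← first-occurrence-injective u u′ u>c u′>c eq =
      cong (u ,_) (trans (sym (strip-tail m v>c)) (trans (cong (strip c) tail≡) (strip-tail m v′>c)))

    children-unique : ∀ {c} m {w} → Above c w → Unique (children c m w)
    children-unique {c} m {w} w>c = unique-map (uncurry (ins c m)) splits-unique inj
      where
      splits-unique : Unique ((w , []) ∷ sites active w)
      splits-unique = All.map (λ { (_ , v≢[] , _) refl → v≢[] refl }) (sites-sound active w)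
                      AllPairs.∷ sites-unique active w
      inj : ∀ {s t} → s ∈ (w , []) ∷ sites active w → t ∈ (w , []) ∷ sites active w →
            uncurry (ins c m) s ≡ uncurry (ins c m) t → s ≡ t
      inj {u , v} {u′ , v′} s∈ t∈ eq
        with eq₁ , _ ← All.lookup (splits-sound w) s∈ | eq₂ , _ ← All.lookup (splits-sound w) t∈
        with u>c , v>c ← All.++⁻ u (subst (Above c) (sym eq₁) w>c)
           | u′>c , v′>c ← All.++⁻ u′ (subst (Above c) (sym eq₂) w>c) =
        ins-injective m u>c v>c u′>c v′>c eq

    enum-unique : ∀ {k} c (mult : Fin k → ℕ) → (∀ j → 1 ≤ mult j) → Unique (enum c mult)
    enum-unique {zero}  c mult mult≥1 = [] AllPairs.∷ AllPairs.[]
    enum-unique {suc k} c mult mult≥1 = unique-concatMap (children (suc c) m)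
      (enum-unique (suc c) (mult ∘ suc) (mult≥1 ∘ suc))
      (λ w∈ → children-unique m (above w∈))
      λ w∈ w′∈ π∈w π∈w′ → origin (above w∈) (above w′∈) π∈w π∈w′
      where
      m = pred (mult zero)
      above : ∀ {w} → w ∈ enum (suc c) (mult ∘ suc) → Above (suc c) w
      above w∈ = spec-above (suc c) (mult ∘ suc) (enum-sound (suc c) (mult ∘ suc) (mult≥1 ∘ suc) w∈)
      origin : ∀ {w w′ π} → Above (suc c) w → Above (suc c) w′ →
               π ∈ children (suc c) m w → π ∈ children (suc c) m w′ → w ≡ w′
      origin w>c w′>c π∈w π∈w′
        with u , v , refl , _ , u>c , v>c , refl ← ∈-children⁻ w>c π∈w
           | u′ , v′ , refl , _ , u′>c , v′>c , eq ← ∈-children⁻ w′>c π∈w′ =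
        cong (uncurry _++_) (ins-injective m u>c v>c u′>c v′>c eq)

    -- The sizes of the children depend on a word only through its own size, so permuted sizes on
    -- one level give permuted sizes on the next.
    enum-sizes : ∀ {k} c (mult : Fin k → ℕ) → (∀ j → 1 ≤ mult j) →
                 map size (enum c mult) ↭ sizeLevel mult
    enum-sizes {zero}  c mult mult≥1 = ↭-refl
    enum-sizes {suc k} c mult mult≥1 = ↭-trans
      (go ws (All.tabulate λ w∈ →
        spec-above (suc c) (mult ∘ suc) (enum-sound (suc c) (mult ∘ suc) (mult≥1 ∘ suc) w∈)))
      (concatMap-↭ (childSizes m) (enum-sizes (suc c) (mult ∘ suc) (mult≥1 ∘ suc)))
      where
      m = pred (mult zero)
      ws = enum (suc c) (mult ∘ suc)
      go : ∀ ws → All (Above (suc c)) ws →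
           map size (concatMap (children (suc c) m) ws) ↭ concatMap (childSizes m) (map size ws)
      go []       []            = ↭-refl
      go (w ∷ ws) (w>c ∷ ws>c) = ↭-trans
        (↭-reflexive (map-++ size (children (suc c) m w) _))
        (Perm.++⁺ (children-sizes siteSizes m w>c) (go ws ws>c))

    av-count : ∀ S → av S (ρ₃ ∷ ρ₄ ∷ []) ≡ length (sizeLevel (Multiset.mult S))
    av-count S = trans (Perm.↭-length avoiders↭enum)
      (trans (sym (length-map size (enum 0 mult))) (Perm.↭-length (enum-sizes 0 mult mult≥1)))
      where
      open Multiset S
      avoiders↭enum : avoiders S (ρ₃ ∷ ρ₄ ∷ []) ↭ enum 0 mult
      avoiders↭enum = ∼bag⇒↭ (unique∧set⇒bag (avoiders-unique S _) (enum-unique 0 mult mult≥1)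
        (⇔.trans (∈-avoiders S _) (mk⇔ (enum-complete 0 mult mult≥1) (enum-sound 0 mult mult≥1))))

    counted : CountedByLevel (ρ₃ ∷ ρ₄ ∷ [])
    counted = countedByLevel av-count

-- A nonempty suffix of s ++ z either starts inside z or contains all of z. This finds β to the
-- right of every place that is to be blocked.
suffix-meets : ∀ {P : ℕ → Set} {z} → All P z → z ≢ [] →
               ∀ p {x q} s → p ++ x ∷ q ≡ s ++ z → Any P (x ∷ q)
suffix-meets []       z≢[] _       _       _  = contradiction refl z≢[]
suffix-meets (pz ∷ _) _    []      s       eq = subst (Any _) (sym eq) (Any.++⁺ʳ s (here pz))
suffix-meets ps       _    (_ ∷ p) []      eq =
  here (All.head (All.++⁻ʳ (_ ∷ p) (subst (All _) (sym eq) ps)))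
suffix-meets ps       z≢[] (_ ∷ p) (_ ∷ s) eq = suffix-meets ps z≢[] p s (∷-injectiveʳ eq)

-- The three pairs

module Scheme112-2312 where

  open Scheme shape112 (false ∷ true ∷ []) false []
    (refl ∷ true ∷ʳ refl ∷ []) (refl ∷ refl ∷ false ∷ʳ [])

  tail-blocked : ∀ {c v} m → Above c v → v ≢ [] → ∃₂ λ h t → v ++ replicate (suc m) c ≡ h ∷ t ×
                 (∀ u p x q → p ++ x ∷ q ≡ t → Bad (u ++ c ∷ h ∷ p) (x ∷ q))
  tail-blocked {v = []} _ _ v≢[] = contradiction refl v≢[]
  -- Here α is the first c with the letter h after it, and β is one of the copies of c at the end.
  tail-blocked {c} {h ∷ v} m (c<h ∷ _) _ = h , _ , refl , λ u p x q eq →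
    c , h , c<h , ++⁺ˡ u (refl ∷ refl ∷ minimum p) ,
    from∈ (suffix-meets {c ≡_} (All.replicate⁺ (suc m) refl) (λ ()) p v eq)

  open BeforeRanked
    (λ u>c _ τ → contradiction (∷-⊆-∷ (⊆-skip (∉-above u>c) τ)) λ ()) tail-blocked

  count-avoiders : CountedByLevel ((1 ∷ 1 ∷ 2 ∷ []) ∷ (2 ∷ 3 ∷ 1 ∷ 2 ∷ []) ∷ [])
  count-avoiders = Enumeration.counted siteSizes

module Scheme121-1223 where

  -- With α empty, the left-hand side of a place has no influence, which calls for `AfterRanked`.
  open Scheme shape121 [] false (false ∷ true ∷ [])
    (refl ∷ refl ∷ true ∷ʳ []) (refl ∷ false ∷ʳ refl ∷ [])

  open AfterRanked
    (λ (x , y , x<y , _ , τ) → x , y , x<y , minimum _ , τ)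
    (λ _ _ _ → refl)
    (λ c<y τ → _ , _ , c<y , minimum _ , τ)

  count-avoiders : CountedByLevel ((1 ∷ 2 ∷ 1 ∷ []) ∷ (1 ∷ 2 ∷ 2 ∷ 3 ∷ []) ∷ [])
  count-avoiders = Enumeration.counted siteSizes

module Scheme121-2213 where

  open Scheme shape121 (false ∷ false ∷ []) true []
    (refl ∷ refl ∷ true ∷ʳ []) (refl ∷ false ∷ʳ refl ∷ [])

  tail-blocked : ∀ {c v} m → Above c v → v ≢ [] → ∃₂ λ h t → replicate (suc m) c ++ v ≡ h ∷ t ×
                 (∀ u p x q → p ++ x ∷ q ≡ t → Bad (u ++ c ∷ h ∷ p) (x ∷ q))
  -- Here α consists of the first two copies of c, and β is any letter of v to the right of the
  -- place.
  tail-blocked {c} m v>c v≢[] = c , _ , refl , λ u p x q eq →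
    let y , y∈q , c<y = find (suffix-meets v>c v≢[] p (replicate m c) eq) in
    c , y , c<y , ++⁺ˡ u (refl ∷ refl ∷ minimum p) , from∈ y∈q

  open BeforeRanked
    (λ u>c _ τ → contradiction (∷-⊆-∷ (⊆-skip (∉-above u>c) τ)) λ ()) tail-blocked

  count-avoiders : CountedByLevel ((1 ∷ 2 ∷ 1 ∷ []) ∷ (2 ∷ 2 ∷ 1 ∷ 3 ∷ []) ∷ [])
  count-avoiders = Enumeration.counted siteSizes

theorem2p14 :
  let P = (1 ∷ 1 ∷ 2 ∷ []) ∷ (2 ∷ 3 ∷ 1 ∷ 2 ∷ []) ∷ []
      Q = (1 ∷ 2 ∷ 1 ∷ []) ∷ (1 ∷ 2 ∷ 2 ∷ 3 ∷ []) ∷ []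
      R = (1 ∷ 2 ∷ 1 ∷ []) ∷ (2 ∷ 2 ∷ 1 ∷ 3 ∷ []) ∷ []
  in (P ∼ Q) × (Q ∼ R) × (P ∼ R)
theorem2p14 =
  countedByLevel⇒∼ _ _ Scheme112-2312.count-avoiders Scheme121-1223.count-avoiders ,
  countedByLevel⇒∼ _ _ Scheme121-1223.count-avoiders Scheme121-2213.count-avoiders ,
  countedByLevel⇒∼ _ _ Scheme112-2312.count-avoiders Scheme121-2213.count-avoiders
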